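{- Let $G$ be a graph with $n$ vertices, and let $b,a,n',m,\Delta$ be non-negative integers with $b-\Delta\ge a\ge 2$, $\delta(G)\ge m+n'+\frac{b(b-\Delta)}{\Delta+a}$ and $n>\frac{(b+a+2m-1)(a+b)}{\Delta+a}+n'$. Let $g,f$ be integer-valued functions on $V(G)$ with $b-\Delta\ge f(x)-\Delta\ge g(x)\ge a$ for every vertex $x$. If for every pair of distinct non-adjacent vertices $x,y$ (i.e. $xy\notin E(G)$) we have $\max\{d_G(x),d_G(y)\}\ge\frac{(b-\Delta)n+(\Delta+a)n'}{b+a}$, then $G$ is fractional $(g,f,n',m)$-critical deleted.
   Context: All graphs are finite and simple; $\delta(G)$ is the minimum degree and $d_G(x)$ the degree of $x$. For integer-valued functions $g\le f$ on $V(G)$, a fractional $(g,f)$-factor of $G$ is a function $h:E(G)\to[0,1]$ such that $g(x)\le\sum_{e\ni x}h(e)\le f(x)$ for every vertex $x$. $G$ is fractional $(g,f,m)$-deleted if for every $H\subseteq E(G)$ with $|H|=m$, $G-H$ has a fractional $(g,f)$-factor. $G$ is fractional $(g,f,n',m)$-critical deleted if for every $U\subseteq V(G)$ with $|U|=n'$, $G-U$ is fractional $(g,f,m)$-deleted (with $g,f$ restricted to $V(G)\setminus U$). -}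

module Defs where

open import Data.Nat using (ℕ; zero; suc; _+_; _*_; _∸_; _≤_; _<_; _⊔_; _<ᵇ_)
open import Data.Bool using (Bool; true; false; _∧_; not; if_then_else_)
open import Data.Fin using (Fin; toℕ)
import Data.Fin as F
open import Data.Vec using (lookup)
open import Data.Fin.Subset using (Subset; ∣_∣)
open import Data.Integer using (+_)
open import Data.Rational using (ℚ; 0ℚ; 1ℚ; _/_) renaming (_≤_ to _≤ℚ_; _+_ to _+ℚ_)
open import Data.Product using (Σ; _×_)
open import Relation.Binary.PropositionalEquality using (_≡_)

sumℚ : (n : ℕ) → (Fin n → ℚ) → ℚ
sumℚ zero    h = 0ℚ
sumℚ (suc n) h = h F.zero +ℚ sumℚ n (λ i → h (F.suc i))

sumℕ : (n : ℕ) → (Fin n → ℕ) → ℕ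
sumℕ zero    h = 0
sumℕ (suc n) h = h F.zero + sumℕ n (λ i → h (F.suc i))

countB : (n : ℕ) → (Fin n → Bool) → ℕ
countB n p = sumℕ n (λ i → if p i then 1 else 0)

ℕtoℚ : ℕ → ℚ
ℕtoℚ k = (+ k) / 1

record Graph (n : ℕ) : Set where
  field
    adj    : Fin n → Fin n → Bool
    sym    : ∀ i j → adj i j ≡ adj j i
    irrefl : ∀ i → adj i i ≡ false
open Graph public

deg : {n : ℕ} → Graph n → Fin n → ℕ
deg {n} G x = countB n (adj G x)

edgeCount : (n : ℕ) → (Fin n → Fin n → Bool) → ℕ
edgeCount n H = sumℕ n (λ i → countB n (λ j → (toℕ i <ᵇ toℕ j) ∧ H i j))

inSet : {n : ℕ} → Subset n → Fin n → Bool
inSet U i = lookup U i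

-- A "subgraph description": vertex set given by live, edges by E
-- (E is only consulted between live vertices).
-- Fractional (g,f)-factor: h : E → [0,1], represented as a function on
-- ordered pairs that is symmetric on edges; only values on edges matter.
FracFactor : (n : ℕ) → (live : Fin n → Bool) → (E : Fin n → Fin n → Bool)
           → (g f : Fin n → ℕ) → Set
FracFactor n live E g f =
  Σ (Fin n → Fin n → ℚ) λ h →
      (∀ i j → (live i ∧ live j ∧ E i j) ≡ true → h i j ≡ h j i)
    × (∀ i j → (live i ∧ live j ∧ E i j) ≡ true → (0ℚ ≤ℚ h i j) × (h i j ≤ℚ 1ℚ))
    × (∀ x → live x ≡ true →
         let dh = sumℚ n (λ j → if (live j ∧ E x j) then h x j else 0ℚ)
         in (ℕtoℚ (g x) ≤ℚ dh) × (dh ≤ℚ ℕtoℚ (f x)))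

liveOut : {n : ℕ} → Subset n → Fin n → Bool
liveOut U i = not (inSet U i)

IsEdgeSetOf : {n : ℕ} → Graph n → Subset n → (Fin n → Fin n → Bool) → Set
IsEdgeSetOf G U H =
    (∀ i j → H i j ≡ H j i)
  × (∀ i j → H i j ≡ true →
       (adj G i j ≡ true) × (liveOut U i ≡ true) × (liveOut U j ≡ true))

FracDeletedAfter : {n : ℕ} → Graph n → Subset n → (g f : Fin n → ℕ) → ℕ → Set
FracDeletedAfter {n} G U g f m =
  ∀ (H : Fin n → Fin n → Bool) → IsEdgeSetOf G U H → edgeCount n H ≡ m →
    FracFactor n (liveOut U) (λ i j → adj G i j ∧ not (H i j)) g f

FracCriticalDeleted : {n : ℕ} → Graph n → (g f : Fin n → ℕ) → (n' m : ℕ) → Set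
FracCriticalDeleted {n} G g f n' m =
  ∀ (U : Subset n) → ∣ U ∣ ≡ n' → FracDeletedAfter G U g f m

{-# OPTIONS --safe #-}
module Submission where

-- Averaging a 0/1 matrix with its transpose gives a fractional (g,f)-factor of G − U − H as
-- soon as the bipartite double cover has a (g,f)-factor.  The latter is found by augmentation;
-- when no augmentation exists, the cut (P , Q) that blocks it can be uncrossed to disjoint
-- T = P ∖ Q and S = Q ∖ P with f(S) + e(T , V ∖ S) < g(T), i.e. a violation of Anstee's condition.
--
-- Let A = Δ + a, B = b − Δ, let d and e be the degrees in G − U − S and G − U − S − H, and
-- restrict T to the vertices with e < B.  Since H has m edges,
-- A|S| < Σ_T (B − e) ≤ Σ_T (B − d) + 2m.  The minimum degree forces |T| > b, and then d(x₁) < B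
-- for the vertex x₁ of T of least d.  Hence T is not contained in the closed neighbourhood of
-- x₁; take x₂ of least d among the other vertices of T.  The degree condition for the
-- non-adjacent pair x₁ , x₂ bounds |S| from below in terms of d(x₂), which contradicts the
-- displayed inequality, bounded above through d(x₁) and d(x₂).

open import Defs renaming (sym to adj-sym)
open import Data.Nat using (ℕ; zero; suc; _+_; _*_; _∸_; _≤_; _<_; _⊔_; _≤?_; _<?_; _<ᵇ_; z≤n; s≤s; s≤s⁻¹; >-nonZero)
open import Data.Nat.Properties hiding (_≟_; _≤?_; _<?_)
open import Data.Nat.Tactic.RingSolver using (solve-∀)
open import Data.Bool using (Bool; true; false; if_then_else_; _∧_; _∨_; not)
import Data.Bool.Properties as Boolₚ
open import Data.Fin using (Fin; zero; suc; toℕ; _≟_)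
open import Data.Fin.Properties using (any?)
import Data.Fin.Properties as Finₚ
open import Data.Fin.Subset using (Subset; ∣_∣)
open import Data.Vec using ([]; _∷_)
import Data.Integer as ℤ
import Data.Integer.Properties as ℤₚ
import Data.Integer.Tactic.RingSolver as ℤ-Solver
open import Data.Rational as ℚ using (ℚ; 0ℚ; 1ℚ; _/_; toℚᵘ)
import Data.Rational.Properties as ℚₚ
open import Data.Rational.Unnormalised as ℚᵘ using (mkℚᵘ; *≡*; *≤*)
import Data.Rational.Unnormalised.Properties as ℚᵘₚ
open import Data.Product using (∃; _×_; _,_; proj₁; proj₂)
open import Data.Sum using (_⊎_; inj₁; inj₂)
open import Data.Empty using (⊥; ⊥-elim)
open import Function using (_∘_; flip; case_of_)
open import Relation.Nullary using (¬_; Dec; yes; no; ¬?; contradiction; ⌊_⌋)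
open import Relation.Nullary.Decidable using (_×-dec_; _⊎-dec_)
open import Relation.Binary using (tri<; tri≈; tri>)
open import Relation.Binary.PropositionalEquality

-- Sums, counts and minima over finite index sets.

infixr 8 _·_
-- Binds tighter than `*`, so `c * T x · 1` is `c` times the indicator of `T` at `x`.
_·_ : Bool → ℕ → ℕ
b · k = if b then k else 0

·-monoʳ-≤ : ∀ b {x y} → x ≤ y → b · x ≤ b · y
·-monoʳ-≤ true  x≤y = x≤y
·-monoʳ-≤ false _   = z≤n

indicator≤1 : ∀ b → b · 1 ≤ 1
indicator≤1 true  = ≤-refl
indicator≤1 false = z≤n

∑-cong : ∀ {n} {u v : Fin n → ℕ} → (∀ i → u i ≡ v i) → sumℕ n u ≡ sumℕ n v
∑-cong {zero}  eq = refl
∑-cong {suc n} eq = cong₂ _+_ (eq zero) (∑-cong (eq ∘ suc))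

∑-mono-≤ : ∀ {n} {u v : Fin n → ℕ} → (∀ i → u i ≤ v i) → sumℕ n u ≤ sumℕ n v
∑-mono-≤ {zero}  le = z≤n
∑-mono-≤ {suc n} le = +-mono-≤ (le zero) (∑-mono-≤ (le ∘ suc))

∑-mono-< : ∀ {n} {u v : Fin n → ℕ} → (∀ i → u i ≤ v i) →
           ∀ i → u i < v i → sumℕ n u < sumℕ n v
∑-mono-< le zero    lt = +-mono-<-≤ lt (∑-mono-≤ (le ∘ suc))
∑-mono-< le (suc i) lt = +-mono-≤-< (le zero) (∑-mono-< (le ∘ suc) i lt)

∑-distrib-+ : ∀ {n} (u v : Fin n → ℕ) →
              sumℕ n (λ i → u i + v i) ≡ sumℕ n u + sumℕ n v
∑-distrib-+ {zero}  u v = refl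
∑-distrib-+ {suc n} u v =
  trans (cong (u zero + v zero +_) (∑-distrib-+ (u ∘ suc) (v ∘ suc)))
        (interchange (u zero) (v zero) _ _)
  where
  interchange : ∀ w x y z → w + x + (y + z) ≡ w + y + (x + z)
  interchange = solve-∀

∑-zero : ∀ n → sumℕ n (λ _ → 0) ≡ 0
∑-zero zero    = refl
∑-zero (suc n) = ∑-zero n

∑-distribˡ-· : ∀ {n} b (u : Fin n → ℕ) → sumℕ n (λ i → b · u i) ≡ b · sumℕ n u
∑-distribˡ-· true  u = refl
∑-distribˡ-· {n} false u = ∑-zero n

∑-distribˡ-* : ∀ {n} c (u : Fin n → ℕ) → sumℕ n (λ i → c * u i) ≡ c * sumℕ n u
∑-distribˡ-* {zero}  c u = sym (*-zeroʳ c)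
∑-distribˡ-* {suc n} c u =
  trans (cong (c * u zero +_) (∑-distribˡ-* c (u ∘ suc)))
        (sym (*-distribˡ-+ c (u zero) _))

∑-const : ∀ n c → sumℕ n (λ _ → c) ≡ n * c
∑-const zero    c = refl
∑-const (suc n) c = cong (c +_) (∑-const n c)

∑-comm : ∀ {n m} (u : Fin n → Fin m → ℕ) →
         sumℕ n (λ i → sumℕ m (u i)) ≡ sumℕ m (λ j → sumℕ n (λ i → u i j))
∑-comm {zero}  {m} u = sym (∑-zero m)
∑-comm {suc n} u =
  trans (cong (sumℕ _ (u zero) +_) (∑-comm (u ∘ suc)))
        (sym (∑-distrib-+ (u zero) (λ j → sumℕ n (λ i → u (suc i) j))))

term≤∑ : ∀ {n} (u : Fin n → ℕ) i → u i ≤ sumℕ n u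
term≤∑ u zero    = m≤m+n _ _
term≤∑ u (suc i) = ≤-trans (term≤∑ (u ∘ suc) i) (m≤n+m _ _)

countB-insert : ∀ {n} (p q : Fin n → Bool) j → (∀ i → i ≢ j → q i ≡ p i) →
                p j ≡ false → q j ≡ true → countB n q ≡ suc (countB n p)
countB-insert p q zero off pj qj rewrite pj | qj =
  cong suc (∑-cong λ i → cong (_· 1) (off (suc i) λ ()))
countB-insert p q (suc j) off pj qj =
  trans (cong₂ _+_ (cong (_· 1) (off zero λ ()))
                   (countB-insert (p ∘ suc) (q ∘ suc) j
                     (λ i i≢j → off (suc i) (i≢j ∘ Finₚ.suc-injective)) pj qj))
        (+-suc _ _)

argmin : ∀ {n} (p : Fin n → Bool) (w : Fin n → ℕ) →
         (∀ i → p i ≡ false) ⊎ ∃ λ i → p i ≡ true × (∀ j → p j ≡ true → w i ≤ w j)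
argmin {zero} p w = inj₁ λ ()
argmin {suc n} p w with p zero in p₀ | argmin (p ∘ suc) (w ∘ suc)
... | false | inj₁ none = inj₁ λ { zero → p₀ ; (suc i) → none i }
... | false | inj₂ (i , pi , least) =
  inj₂ (suc i , pi , λ { zero pj → contradiction (trans (sym p₀) pj) λ () ; (suc j) → least j })
... | true | inj₁ none =
  inj₂ (zero , p₀ , λ { zero _ → ≤-refl ; (suc j) pj → contradiction (trans (sym (none j)) pj) λ () })
... | true | inj₂ (i , pi , least) with ≤-total (w zero) (w (suc i))
...   | inj₁ w₀≤ = inj₂ (zero , p₀ , λ { zero _ → ≤-refl ; (suc j) pj → ≤-trans w₀≤ (least j pj) })
...   | inj₂ ≤w₀ = inj₂ (suc i , pi , λ { zero _ → ≤w₀ ; (suc j) → least j })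

-- For comparisons that need slack at one index: in `row-H` the zero diagonal entry makes room for a
-- whole row, in `p≤` the constant 1 pays for `x₁`.
∑-exchange : ∀ {n} {u v : Fin n → ℕ} {c c′} x → (∀ i → i ≢ x → u i ≤ v i) →
             u x + c ≤ v x + c′ → sumℕ n u + c ≤ sumℕ n v + c′
∑-exchange {u = u} {v} {c} {c′} zero le at = begin
  u zero + sumℕ _ (u ∘ suc) + c     ≡⟨ rearrange (u zero) _ c ⟩
  u zero + c + sumℕ _ (u ∘ suc)     ≤⟨ +-mono-≤ at (∑-mono-≤ λ i → le (suc i) λ ()) ⟩
  v zero + c′ + sumℕ _ (v ∘ suc)    ≡⟨ rearrange (v zero) c′ _ ⟩
  v zero + sumℕ _ (v ∘ suc) + c′    ∎
  where
  open ≤-Reasoning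
  rearrange : ∀ x y z → x + y + z ≡ x + z + y
  rearrange = solve-∀
∑-exchange {u = u} {v} {c} {c′} (suc x) le at = begin
  u zero + sumℕ _ (u ∘ suc) + c     ≡⟨ +-assoc (u zero) _ c ⟩
  u zero + (sumℕ _ (u ∘ suc) + c)
    ≤⟨ +-mono-≤ (le zero λ ()) (∑-exchange x (λ i i≢x → le (suc i) (i≢x ∘ Finₚ.suc-injective)) at) ⟩
  v zero + (sumℕ _ (v ∘ suc) + c′)  ≡⟨ +-assoc (v zero) _ c′ ⟨
  v zero + sumℕ _ (v ∘ suc) + c′    ∎
  where open ≤-Reasoning

-- Degree-constrained 0/1 matrices

module _ {n : ℕ} where

  Matrix : Set
  Matrix = Fin n → Fin n → Bool

  row col : Matrix → Fin n → ℕ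
  row φ x = countB n (φ x)
  col φ y = countB n (λ x → φ x y)

  -- A relation and not an operation, so that clearing an entry is the same step read backwards and
  -- one count serves both.
  record Adds (φ ψ : Matrix) (i j : Fin n) : Set where
    field
      off    : ∀ x y → (x ≢ i) ⊎ (y ≢ j) → ψ x y ≡ φ x y
      before : φ i j ≡ false
      after  : ψ i j ≡ true

  open Adds

  Adds-flip : ∀ {φ ψ i j} → Adds φ ψ i j → Adds (flip φ) (flip ψ) j i
  Adds-flip s .off x y (inj₁ x≢) = s .off y x (inj₂ x≢)
  Adds-flip s .off x y (inj₂ y≢) = s .off y x (inj₁ y≢)
  Adds-flip s .before = s .before
  Adds-flip s .after  = s .after

  row-at : ∀ {φ ψ i j} → Adds φ ψ i j → row ψ i ≡ suc (row φ i)
  row-at {φ} {ψ} {i} {j} s =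
    countB-insert (φ i) (ψ i) j (λ y y≢j → s .off i y (inj₂ y≢j)) (s .before) (s .after)

  row-off : ∀ {φ ψ i j} → Adds φ ψ i j → ∀ x → x ≢ i → row ψ x ≡ row φ x
  row-off s x x≢i = ∑-cong λ y → cong (_· 1) (s .off x y (inj₁ x≢i))

  col-at : ∀ {φ ψ i j} → Adds φ ψ i j → col ψ j ≡ suc (col φ j)
  col-at s = row-at (Adds-flip s)

  col-off : ∀ {φ ψ i j} → Adds φ ψ i j → ∀ y → y ≢ j → col ψ y ≡ col φ y
  col-off s = row-off (Adds-flip s)

  set : Matrix → Fin n → Fin n → Bool → Matrix
  set φ i j v x y with x ≟ i | y ≟ j
  ... | yes _ | yes _ = v
  ... | _     | _     = φ x y

  set-at : ∀ φ i j v → set φ i j v i j ≡ v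
  set-at φ i j v with i ≟ i | j ≟ j
  ... | yes _ | yes _ = refl
  ... | no i≢i | _    = contradiction refl i≢i
  ... | yes _ | no j≢j = contradiction refl j≢j

  set-off : ∀ φ i j v x y → (x ≢ i) ⊎ (y ≢ j) → set φ i j v x y ≡ φ x y
  set-off φ i j v x y h with x ≟ i | y ≟ j | h
  ... | yes x≡i | yes _   | inj₁ x≢i = contradiction x≡i x≢i
  ... | yes _   | yes y≡j | inj₂ y≢j = contradiction y≡j y≢j
  ... | yes _   | no _    | _ = refl
  ... | no _    | yes _   | _ = refl
  ... | no _    | no _    | _ = refl

  set-true : ∀ φ i j → φ i j ≡ false → Adds φ (set φ i j true) i j
  set-true φ i j φij .off    = set-off φ i j true
  set-true φ i j φij .before = φij
  set-true φ i j φij .after  = set-at φ i j true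

  set-false : ∀ φ i j → φ i j ≡ true → Adds (set φ i j false) φ i j
  set-false φ i j φij .off x y h = sym (set-off φ i j false x y h)
  set-false φ i j φij .before    = set-at φ i j false
  set-false φ i j φij .after     = φij

  _⊑_ : Matrix → Matrix → Set
  φ ⊑ E = ∀ x y → φ x y ≡ true → E x y ≡ true

  set-⊑ : ∀ {E} φ i j v → φ ⊑ E → (v ≡ true → E i j ≡ true) → set φ i j v ⊑ E
  set-⊑ φ i j v φ⊑E vE x y h with x ≟ i | y ≟ j
  ... | yes refl | yes refl = vE h
  ... | yes _    | no _     = φ⊑E x y h
  ... | no _     | yes _    = φ⊑E x y h
  ... | no _     | no _     = φ⊑E x y h

  -- The entry of row `k` in column `j` moves to row `i`: two consecutive edges of an alternating
  -- path.
  record Shifts (φ ψ : Matrix) (i k j : Fin n) : Set where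
    field
      off-col  : ∀ x y → y ≢ j → ψ x y ≡ φ x y
      row-gain : row ψ i ≡ suc (row φ i)
      row-loss : suc (row ψ k) ≡ row φ k
      row-same : ∀ x → x ≢ i → x ≢ k → row ψ x ≡ row φ x
      col-same : ∀ y → col ψ y ≡ col φ y

  open Shifts

  shift : ∀ {E} φ i k j → φ ⊑ E → E i j ≡ true → φ i j ≡ false → φ k j ≡ true →
          ∃ λ ψ → ψ ⊑ E × Shifts φ ψ i k j
  shift {E} φ i k j φ⊑E Eij φij φkj =
    ψ , set-⊑ φ₁ i j true (set-⊑ φ k j false φ⊑E (λ ())) (λ _ → Eij) , record
      { off-col  = λ x y y≢j → trans (gain .off x y (inj₂ y≢j)) (sym (loss .off x y (inj₂ y≢j)))
      ; row-gain = trans (row-at gain) (cong suc (sym (row-off loss i i≢k)))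
      ; row-loss = trans (cong suc (row-off gain k (i≢k ∘ sym))) (sym (row-at loss))
      ; row-same = λ x x≢i x≢k → trans (row-off gain x x≢i) (sym (row-off loss x x≢k))
      ; col-same = col-same′
      }
    where
    i≢k : i ≢ k
    i≢k refl = contradiction (trans (sym φij) φkj) λ ()

    φ₁ ψ : Matrix
    φ₁ = set φ k j false
    ψ  = set φ₁ i j true

    loss : Adds φ₁ φ k j
    loss = set-false φ k j φkj

    gain : Adds φ₁ ψ i j
    gain = set-true φ₁ i j (trans (set-off φ k j false i j (inj₁ i≢k)) φij)

    col-same′ : ∀ y → col ψ y ≡ col φ y
    col-same′ y = case y ≟ j of λ where
      (yes refl) → trans (col-at gain) (sym (col-at loss))
      (no y≢j)   → trans (col-off gain y y≢j) (sym (col-off loss y y≢j))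

  -- A Hall-type condition in the bipartite double cover: the demand of the rows in `P` is absorbed
  -- by the columns in `Q`, at most `f` each, or leaves along edges to the other columns.
  CutCondition : Matrix → (g f : Fin n → ℕ) → Set
  CutCondition E g f = ∀ (P Q : Fin n → Bool) →
    sumℕ n (λ x → P x · g x) ≤
    sumℕ n (λ y → Q y · f y) + sumℕ n (λ x → P x · countB n (λ y → not (Q y) ∧ E x y))

  record UpperFeasible (E : Matrix) (f : Fin n → ℕ) (φ : Matrix) : Set where
    field
      below : φ ⊑ E
      row≤f : ∀ x → row φ x ≤ f x
      col≤f : ∀ y → col φ y ≤ f y

  open UpperFeasible

  -- Augmenting paths in the bipartite double cover.

  module Augment (E : Matrix) (g f : Fin n → ℕ) (g≤f : ∀ x → g x ≤ f x)
                 (φ : Matrix) (feasible : UpperFeasible E f φ) where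

    -- By `row≥` and `col≥` no deficit below `g` grows: another row may lose units only if it stays
    -- at or above its lower bound.
    record Augmentation (i : Fin n) (D : Fin n → Bool) : Set where
      field
        result  : Matrix
        result⊑ : result ⊑ E
        fixed   : ∀ x y → D y ≡ false → result x y ≡ φ x y
        gain    : row result i ≡ suc (row φ i)
        row≤    : ∀ x → x ≢ i → row result x ≤ row φ x
        row≥    : ∀ x → x ≢ i → row φ x ≤ row result x ⊎ g x ≤ row result x
        col≥    : ∀ y → col φ y ≤ col result y
        col≤    : ∀ y → col result y ≤ f y

    open Augmentation

    Missing : (Fin n → Bool) → Fin n → Fin n → Set
    Missing D i j = D j ≡ true × E i j ≡ true × φ i j ≡ false

    missing? : ∀ D i j → Dec (Missing D i j)
    missing? D i j = (D j Boolₚ.≟ true) ×-dec ((E i j Boolₚ.≟ true) ×-dec (φ i j Boolₚ.≟ false))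

    -- Growing a good set of columns replaces the search for an augmenting path.
    Good : (Fin n → Bool) → Set
    Good D = ∀ i j → Missing D i j → row φ i ≤ g i → Augmentation i D

    Extends : (Fin n → Bool) → Fin n → Set
    Extends D j = col φ j < f j ⊎
      ∃ λ k → φ k j ≡ true × (g k < row φ k ⊎ ∃ (Missing D k))

    extends? : ∀ D j → Dec (Extends D j)
    extends? D j = (col φ j <? f j) ⊎-dec
      any? λ k → (φ k j Boolₚ.≟ true) ×-dec ((g k <? row φ k) ⊎-dec any? (missing? D k))

    insert : (Fin n → Bool) → Fin n → Fin n → Bool
    insert D j y with y ≟ j
    ... | yes _ = true
    ... | no _  = D y

    insert-at : ∀ D j → insert D j j ≡ true
    insert-at D j with j ≟ j
    ... | yes _   = refl
    ... | no j≢j = contradiction refl j≢j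

    insert-off : ∀ D j y → y ≢ j → insert D j y ≡ D y
    insert-off D j y y≢j with y ≟ j
    ... | yes y≡j = contradiction y≡j y≢j
    ... | no _    = refl

    outside-insert : ∀ D j y → insert D j y ≡ false → y ≢ j × D y ≡ false
    outside-insert D j y h with y ≟ j
    ... | no y≢j = y≢j , h

    widen : ∀ {i} D j → Augmentation i D → Augmentation i (insert D j)
    widen D j α = record
      { Augmentation α
      ; fixed = λ x y y∉ → α .fixed x y (proj₂ (outside-insert D j y y∉))
      }

    augment-end : ∀ D i j → E i j ≡ true → φ i j ≡ false → col φ j < f j →
                  Augmentation i (insert D j)
    augment-end D i j Eij φij col< = record
      { result  = set φ i j true
      ; result⊑ = set-⊑ φ i j true (below feasible) (λ _ → Eij)
      ; fixed   = λ x y y∉ → adds .off x y (inj₂ (proj₁ (outside-insert D j y y∉)))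
      ; gain    = row-at adds
      ; row≤    = λ x x≢i → ≤-reflexive (row-off adds x x≢i)
      ; row≥    = λ x x≢i → inj₁ (≤-reflexive (sym (row-off adds x x≢i)))
      ; col≥    = λ y → proj₁ (cols y)
      ; col≤    = λ y → proj₂ (cols y)
      }
      where
      adds : Adds φ (set φ i j true) i j
      adds = set-true φ i j φij

      cols : ∀ y → col φ y ≤ col (set φ i j true) y × col (set φ i j true) y ≤ f y
      cols y = case y ≟ j of λ where
        (yes refl) → subst (λ c → col φ j ≤ c × c ≤ f j) (sym (col-at adds)) (n≤1+n _ , col<)
        (no y≢j)   → subst (λ c → col φ y ≤ c × c ≤ f y) (sym (col-off adds y y≢j))
                           (≤-refl , col≤f feasible y)

    augment-surplus : ∀ D i k j → E i j ≡ true → φ i j ≡ false →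
                      φ k j ≡ true → g k < row φ k → Augmentation i (insert D j)
    augment-surplus D i k j Eij φij φkj g<row = record
      { result  = ψ
      ; result⊑ = proj₁ (proj₂ shifted)
      ; fixed   = λ x y y∉ → s .off-col x y (proj₁ (outside-insert D j y y∉))
      ; gain    = s .row-gain
      ; row≤    = λ x x≢i → proj₁ (rows x x≢i)
      ; row≥    = λ x x≢i → proj₂ (rows x x≢i)
      ; col≥    = λ y → ≤-reflexive (sym (s .col-same y))
      ; col≤    = λ y → subst (_≤ f y) (sym (s .col-same y)) (col≤f feasible y)
      }
      where
      shifted = shift φ i k j (below feasible) Eij φij φkj
      ψ = proj₁ shifted
      s = proj₂ (proj₂ shifted)

      rows : ∀ x → x ≢ i → row ψ x ≤ row φ x × (row φ x ≤ row ψ x ⊎ g x ≤ row ψ x)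
      rows x x≢i = case x ≟ k of λ where
        (yes refl) → subst (row ψ k ≤_) (s .row-loss) (n≤1+n _) ,
                     inj₂ (s≤s⁻¹ (subst (g k <_) (sym (s .row-loss)) g<row))
        (no x≢k)   → ≤-reflexive (s .row-same x x≢i x≢k) ,
                     inj₁ (≤-reflexive (sym (s .row-same x x≢i x≢k)))

    -- The augmentation from k only touches columns in D, so the entries (i , j) and
    -- (k , j) of column j ∉ D can still be exchanged afterwards.
    augment-step : ∀ D i k j → D j ≡ false → E i j ≡ true → φ i j ≡ false → row φ i ≤ g i →
                   φ k j ≡ true → Augmentation k D → Augmentation i (insert D j)
    augment-step D i k j j∉D Eij φij row≤g φkj α = record
      { result  = ψ
      ; result⊑ = proj₁ (proj₂ shifted)
      ; fixed   = λ x y y∉ → let y≢j , y∉D = outside-insert D j y y∉ in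
                    trans (s .off-col x y y≢j) (α .fixed x y y∉D)
      ; gain    = trans (s .row-gain) (cong suc (≤-antisym (α .row≤ i i≢k) row-i≥))
      ; row≤    = λ x x≢i → proj₁ (rows x x≢i)
      ; row≥    = λ x x≢i → proj₂ (rows x x≢i)
      ; col≥    = λ y → subst (col φ y ≤_) (sym (s .col-same y)) (α .col≥ y)
      ; col≤    = λ y → subst (_≤ f y) (sym (s .col-same y)) (α .col≤ y)
      }
      where
      shifted = shift (α .result) i k j (α .result⊑) Eij
                      (trans (α .fixed i j j∉D) φij) (trans (α .fixed k j j∉D) φkj)
      ψ = proj₁ shifted
      s = proj₂ (proj₂ shifted)

      i≢k : i ≢ k
      i≢k refl = contradiction (trans (sym φij) φkj) λ ()

      -- If the augmentation from `k` only guarantees `g i` in row `i`, then `row φ i ≤ g i` still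
      -- shows that this row has lost nothing.
      row-i≥ : row φ i ≤ row (α .result) i
      row-i≥ with α .row≥ i i≢k
      ... | inj₁ le = le
      ... | inj₂ le = ≤-trans row≤g le

      rows : ∀ x → x ≢ i → row ψ x ≤ row φ x × (row φ x ≤ row ψ x ⊎ g x ≤ row ψ x)
      rows x x≢i = case x ≟ k of λ where
        (yes refl) → let same = suc-injective (trans (s .row-loss) (α .gain)) in
                     ≤-reflexive same , inj₁ (≤-reflexive (sym same))
        (no x≢k)   → subst (λ r → r ≤ row φ x × (row φ x ≤ r ⊎ g x ≤ r))
                           (sym (s .row-same x x≢i x≢k)) (α .row≤ x x≢k , α .row≥ x x≢k)

    insert-good : ∀ D j → D j ≡ false → Good D → Extends D j → Good (insert D j)
    insert-good D j j∉D good ext i y (y∈ , Eiy , φiy) row≤g with y ≟ j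
    ... | no _ = widen D j (good i y (y∈ , Eiy , φiy) row≤g)
    ... | yes refl with ext
    ...   | inj₁ col< = augment-end D i j Eiy φiy col<
    ...   | inj₂ (k , φkj , inj₁ g<row) = augment-surplus D i k j Eiy φiy φkj g<row
    -- `good` covers only rows that are not in surplus; a surplus row gives up its entry in column
    -- `j` without a refill.
    ...   | inj₂ (k , φkj , inj₂ (j′ , missing)) with g k <? row φ k
    ...     | yes g<row = augment-surplus D i k j Eiy φiy φkj g<row
    ...     | no g≮row  =
      augment-step D i k j j∉D Eiy φiy row≤g φkj (good k j′ missing (≮⇒≥ g≮row))

    -- Each insertion lowers the number of columns outside `D`, which `fuel` bounds.
    saturate : ∀ fuel D → countB n (not ∘ D) ≤ fuel → Good D →
               ∃ λ D′ → Good D′ × (∀ j → D′ j ≡ false → ¬ Extends D′ j)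
    saturate fuel D size good with any? (λ j → (D j Boolₚ.≟ false) ×-dec extends? D j)
    ... | no none = D , good , λ j j∉D ext → none (j , j∉D , ext)
    ... | yes (j , j∉D , ext) = continue fuel (subst (_≤ fuel) shrinks size)
      where
      shrinks : countB n (not ∘ D) ≡ suc (countB n (not ∘ insert D j))
      shrinks = countB-insert _ _ j (λ y y≢j → cong not (sym (insert-off D j y y≢j)))
                  (cong not (insert-at D j)) (cong not j∉D)

      continue : ∀ fuel → suc (countB n (not ∘ insert D j)) ≤ fuel →
                 ∃ λ D′ → Good D′ × (∀ j → D′ j ≡ false → ¬ Extends D′ j)
      continue (suc fuel) (s≤s size′) =
        saturate fuel (insert D j) size′ (insert-good D j j∉D good ext)

    -- If D cannot be extended, then its complement Q and the set P of rows that are not in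
    -- surplus and have no unused edge into D violate the cut condition.
    saturated-cut : ∀ D i₀ → (∀ j → D j ≡ false → ¬ Extends D j) →
                    row φ i₀ < g i₀ → ¬ ∃ (Missing D i₀) → ¬ CutCondition E g f
    saturated-cut D i₀ closed deficient none cut =
      -- The chain is Σ_P row < Σ_P g ≤ f(Q) + e(P , D) ≤ Σ_P row.
      <-irrefl refl (<-≤-trans deficit (≤-trans (cut P Q) bound))
      where
      P? : ∀ x → Dec (row φ x ≤ g x × ¬ ∃ (Missing D x))
      P? x = (row φ x ≤? g x) ×-dec ¬? (any? (missing? D x))

      P Q : Fin n → Bool
      P x = ⌊ P? x ⌋
      Q y = not (D y)

      deficit : sumℕ n (λ x → P x · row φ x) < sumℕ n (λ x → P x · g x)
      deficit = ∑-mono-< le i₀ lt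
        where
        le : ∀ x → P x · row φ x ≤ P x · g x
        le x with P? x
        ... | yes (row≤g , _) = row≤g
        ... | no _            = z≤n

        lt : P i₀ · row φ i₀ < P i₀ · g i₀
        lt with P? i₀
        ... | yes _ = deficient
        ... | no ¬P = contradiction (<⇒≤ deficient , none) ¬P

      entry : ∀ x y → P x ≡ true → (Q y ∧ φ x y) · 1 + (not (Q y) ∧ E x y) · 1 ≤ φ x y · 1
      entry x y Px with P? x | D y in Dy | φ x y in φxy | E x y in Exy
      ... | yes _ | false | true  | _     = ≤-refl
      ... | yes _ | false | false | _     = z≤n
      ... | yes _ | true  | true  | true  = ≤-refl
      ... | yes _ | true  | true  | false = z≤n
      ... | yes _ | true  | false | false = z≤n
      ... | yes (_ , ¬missing) | true | false | true = contradiction (y , Dy , Exy , φxy) ¬missing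

      -- A column outside `D` does not extend `D`, so every row that uses it lies in `P`.
      used : ∀ x y → D y ≡ false → φ x y ≡ true → row φ x ≤ g x × ¬ ∃ (Missing D x)
      used x y Dy φxy =
        ≮⇒≥ (λ g<row → closed y Dy (inj₂ (x , φxy , inj₁ g<row))) ,
        λ missing → closed y Dy (inj₂ (x , φxy , inj₂ missing))

      unused : ∀ x y → P x ≡ false → (Q y ∧ φ x y) · 1 ≡ 0
      unused x y Px with P? x | D y in Dy | φ x y in φxy
      ... | no ¬P | false | true  = contradiction (used x y Dy φxy) ¬P
      ... | no _  | false | false = refl
      ... | no _  | true  | _     = refl

      rows : ∀ x → countB n (λ y → Q y ∧ φ x y) + P x · countB n (λ y → not (Q y) ∧ E x y)
                   ≤ P x · row φ x
      rows x with P x in Px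
      ... | true  = subst (_≤ row φ x) (∑-distrib-+ {n} _ _) (∑-mono-≤ λ y → entry x y Px)
      ... | false = ≤-reflexive (trans (+-identityʳ _)
                      (trans (∑-cong λ y → unused x y Px) (∑-zero n)))

      columns : ∀ y → Q y · f y ≤ countB n (λ x → Q y ∧ φ x y)
      columns y with D y in Dy
      ... | true  = z≤n
      ... | false = ≮⇒≥ (λ col< → closed y Dy (inj₁ col<))

      open ≤-Reasoning

      bound : sumℕ n (λ y → Q y · f y) + sumℕ n (λ x → P x · countB n (λ y → not (Q y) ∧ E x y))
              ≤ sumℕ n (λ x → P x · row φ x)
      bound = begin
        sumℕ n (λ y → Q y · f y) + out
          ≤⟨ +-monoˡ-≤ out (∑-mono-≤ columns) ⟩
        sumℕ n (λ y → countB n (λ x → Q y ∧ φ x y)) + out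
          ≡⟨ cong (_+ out) (∑-comm (λ y x → (Q y ∧ φ x y) · 1)) ⟩
        sumℕ n (λ x → countB n (λ y → Q y ∧ φ x y)) + out
          ≡⟨ ∑-distrib-+ {n} _ _ ⟨
        sumℕ n (λ x → countB n (λ y → Q y ∧ φ x y) + P x · countB n (λ y → not (Q y) ∧ E x y))
          ≤⟨ ∑-mono-≤ rows ⟩
        sumℕ n (λ x → P x · row φ x) ∎
        where out = sumℕ n (λ x → P x · countB n (λ y → not (Q y) ∧ E x y))

    augment : CutCondition E g f → ∀ i₀ → row φ i₀ < g i₀ → ∃ (Augmentation i₀)
    augment cut i₀ deficient
      -- The empty set of columns is good because no edge enters it.
      with saturate _ (λ _ → false) ≤-refl (λ { _ _ (() , _) })
    ... | D , good , closed with any? (missing? D i₀)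
    ...   | yes (j , missing) = D , good i₀ j missing (<⇒≤ deficient)
    ...   | no none = ⊥-elim (saturated-cut D i₀ closed deficient none cut)

    -- The gain lowers the deficit of row `i₀`, which started strictly below `g` and so stays within
    -- `f`; no other row or column deficit grows.
    improve : CutCondition E g f → ∀ i₀ → row φ i₀ < g i₀ →
      ∃ λ ψ → UpperFeasible E f ψ ×
        sumℕ n (λ x → g x ∸ row ψ x) + sumℕ n (λ y → g y ∸ col ψ y)
        < sumℕ n (λ x → g x ∸ row φ x) + sumℕ n (λ y → g y ∸ col φ y)
    improve cut i₀ deficient with augment cut i₀ deficient
    ... | D , α = α .result
                , record { below = α .result⊑ ; row≤f = rows≤f ; col≤f = α .col≤ }
                , +-mono-<-≤ (∑-mono-< rows i₀ row-i₀) (∑-mono-≤ λ y → ∸-monoʳ-≤ (g y) (α .col≥ y))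
      where
      rows≤f : ∀ x → row (α .result) x ≤ f x
      rows≤f x with x ≟ i₀
      ... | yes refl = ≤-trans (subst (_≤ g x) (sym (α .gain)) deficient) (g≤f x)
      ... | no x≢i₀  = ≤-trans (α .row≤ x x≢i₀) (row≤f feasible x)

      row-i₀ : g i₀ ∸ row (α .result) i₀ < g i₀ ∸ row φ i₀
      row-i₀ = ∸-monoʳ-< (subst (row φ i₀ <_) (sym (α .gain)) ≤-refl)
                         (subst (_≤ g i₀) (sym (α .gain)) deficient)

      rows : ∀ x → g x ∸ row (α .result) x ≤ g x ∸ row φ x
      rows x with x ≟ i₀
      ... | yes refl = <⇒≤ row-i₀
      ... | no x≢i₀ with α .row≥ x x≢i₀
      ...   | inj₁ le = ∸-monoʳ-≤ (g x) le
      ...   | inj₂ le = subst (_≤ g x ∸ row φ x) (sym (m≤n⇒m∸n≡0 le)) z≤n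

  -- Bipartite factors from the cut condition.

  record BipartiteFactor (E : Matrix) (g f : Fin n → ℕ) : Set where
    field
      matrix : Matrix
      upper  : UpperFeasible E f matrix
      g≤row  : ∀ x → g x ≤ row matrix x
      g≤col  : ∀ y → g y ≤ col matrix y

  module _ (E : Matrix) (E-sym : ∀ x y → E x y ≡ E y x)
           (g f : Fin n → ℕ) (g≤f : ∀ x → g x ≤ f x) (cut : CutCondition E g f) where

    UpperFeasible-flip : ∀ {φ} → UpperFeasible E f φ → UpperFeasible E f (flip φ)
    UpperFeasible-flip feasible = record
      { below = λ x y h → trans (E-sym x y) (below feasible y x h)
      ; row≤f = col≤f feasible
      ; col≤f = row≤f feasible
      }

    -- Induction on the total deficit of rows and columns. A deficient column is a deficient row of
    -- the transpose, which is again feasible because `E` is symmetric.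
    bipartiteFactor-from : ∀ fuel φ → UpperFeasible E f φ →
      sumℕ n (λ x → g x ∸ row φ x) + sumℕ n (λ y → g y ∸ col φ y) < fuel →
      BipartiteFactor E g f
    bipartiteFactor-from (suc fuel) φ feasible (s≤s size)
      with any? (λ x → row φ x <? g x) | any? (λ y → col φ y <? g y)
    ... | no rows | no cols = record
      { matrix = φ
      ; upper  = feasible
      ; g≤row  = λ x → ≮⇒≥ λ lt → rows (x , lt)
      ; g≤col  = λ y → ≮⇒≥ λ lt → cols (y , lt)
      }
    ... | yes (x , lt) | _ =
      let ψ , feasible′ , smaller = Augment.improve E g f g≤f φ feasible cut x lt in
      bipartiteFactor-from fuel ψ feasible′ (<-≤-trans smaller size)
    ... | no _ | yes (y , lt) =
      let ψ , feasible′ , smaller =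
            Augment.improve E g f g≤f (flip φ) (UpperFeasible-flip feasible) cut y lt in
      bipartiteFactor-from fuel ψ feasible′
        (<-≤-trans smaller (subst (_≤ fuel) (+-comm (sumℕ n (λ x → g x ∸ row φ x)) _) size))

    bipartiteFactor : BipartiteFactor E g f
    bipartiteFactor = bipartiteFactor-from _ (λ _ _ → false) (record
      { below = λ _ _ ()
      ; row≤f = λ x → subst (_≤ f x) (sym (∑-zero n)) z≤n
      ; col≤f = λ y → subst (_≤ f y) (sym (∑-zero n)) z≤n
      }) ≤-refl

-- Anstee's condition for disjoint `T` and `S`, and uncrossing.

DisjointCutCondition : ∀ {n} → (Fin n → Fin n → Bool) → (g f : Fin n → ℕ) → Set
DisjointCutCondition {n} E g f = ∀ (T S : Fin n → Bool) → (∀ x → T x ≡ true → S x ≡ false) →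
  sumℕ n (λ x → T x · g x) ≤
  sumℕ n (λ y → S y · f y) + sumℕ n (λ x → T x · countB n (λ y → not (S y) ∧ E x y))

-- Removing W = P ∩ Q from both sides costs the edges between P ∖ Q and W, which by the
-- symmetry of E are paid for by the edges from W to the complement of Q.
uncross : ∀ {n} (E : Fin n → Fin n → Bool) (g f : Fin n → ℕ) →
  (∀ x y → E x y ≡ E y x) → (∀ x → g x ≤ f x) →
  DisjointCutCondition E g f → CutCondition E g f
uncross {n} E g f E-sym g≤f disjoint P Q = begin
  sumℕ n (λ x → P x · g x)
    ≡⟨ split P Q g ⟩
  sumℕ n (λ x → T x · g x) + sumℕ n (λ x → (P x ∧ Q x) · g x)
    ≤⟨ +-mono-≤ (disjoint T S T∩S) (∑-mono-≤ λ x → ·-monoʳ-≤ (P x ∧ Q x) (g≤f x)) ⟩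
  sumℕ n (λ y → S y · f y) + edges T (λ y → not (S y)) + sumℕ n (λ x → (P x ∧ Q x) · f x)
    ≡⟨ rearrange (sumℕ n (λ y → S y · f y)) _ _ ⟩
  sumℕ n (λ y → S y · f y) + sumℕ n (λ x → (P x ∧ Q x) · f x) + edges T (λ y → not (S y))
    ≤⟨ +-mono-≤ (≤-reflexive (sym f-split)) edges-≤ ⟩
  sumℕ n (λ y → Q y · f y) + edges P (λ y → not (Q y)) ∎
  where
  open ≤-Reasoning

  T S W : Fin n → Bool
  T x = P x ∧ not (Q x)
  S y = Q y ∧ not (P y)
  W x = P x ∧ Q x

  edges : (Fin n → Bool) → (Fin n → Bool) → ℕ
  edges X Y = sumℕ n (λ x → X x · countB n (λ y → Y y ∧ E x y))

  edges-∑∑ : ∀ X Y → edges X Y ≡ sumℕ n (λ x → sumℕ n (λ y → X x · (Y y ∧ E x y) · 1))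
  edges-∑∑ X Y = ∑-cong λ x → sym (∑-distribˡ-· (X x) (λ y → (Y y ∧ E x y) · 1))

  rearrange : ∀ x y z → x + y + z ≡ x + z + y
  rearrange = solve-∀

  T∩S : ∀ x → T x ≡ true → S x ≡ false
  T∩S x Tx with P x | Q x
  ... | true | false = refl

  split : ∀ (X Y : Fin n → Bool) (u : Fin n → ℕ) →
    sumℕ n (λ x → X x · u x) ≡
    sumℕ n (λ x → (X x ∧ not (Y x)) · u x) + sumℕ n (λ x → (X x ∧ Y x) · u x)
  split X Y u = trans (∑-cong pointwise) (∑-distrib-+ {n} _ _)
    where
    pointwise : ∀ x → X x · u x ≡ (X x ∧ not (Y x)) · u x + (X x ∧ Y x) · u x
    pointwise x with X x | Y x
    ... | true  | true  = refl
    ... | true  | false = sym (+-identityʳ _)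
    ... | false | _     = refl

  f-split : sumℕ n (λ y → Q y · f y) ≡
            sumℕ n (λ y → S y · f y) + sumℕ n (λ x → W x · f x)
  f-split = trans (split Q P f) (cong (sumℕ n (λ y → S y · f y) +_) (∑-cong commute))
    where
    commute : ∀ x → (Q x ∧ P x) · f x ≡ W x · f x
    commute x with P x | Q x
    ... | true  | true  = refl
    ... | true  | false = refl
    ... | false | true  = refl
    ... | false | false = refl

  edges-flip : edges T W ≡ edges W T
  edges-flip = trans (edges-∑∑ T W)
    (trans (∑-comm (λ x y → T x · (W y ∧ E x y) · 1))
    (trans (∑-cong λ y → ∑-cong λ x → exchange x y) (sym (edges-∑∑ W T))))
    where
    exchange : ∀ x y → T x · (W y ∧ E x y) · 1 ≡ W y · (T x ∧ E y x) · 1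
    exchange x y rewrite E-sym y x with T x | W y | E x y
    ... | true  | true  | _     = refl
    ... | true  | false | _     = refl
    ... | false | true  | _     = refl
    ... | false | false | _     = refl

  edges-≤ : edges T (λ y → not (S y)) ≤ edges P (λ y → not (Q y))
  edges-≤ = begin
    edges T (λ y → not (S y))
      ≤⟨ ∑-mono-≤ (λ x → ≤-trans (·-monoʳ-≤ (T x)
           (subst (countB n (λ y → not (S y) ∧ E x y) ≤_) (∑-distrib-+ {n} _ _)
             (∑-mono-≤ λ y → outside (P y) (Q y) (E x y))))
           (≤-reflexive (·-distrib-+ (T x)))) ⟩
    sumℕ n (λ x → T x · countB n (λ y → not (Q y) ∧ E x y) + T x · countB n (λ y → W y ∧ E x y))
      ≡⟨ ∑-distrib-+ {n} _ _ ⟩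
    edges T (λ y → not (Q y)) + edges T W
      ≡⟨ cong (edges T (λ y → not (Q y)) +_) edges-flip ⟩
    edges T (λ y → not (Q y)) + edges W T
      ≡⟨ ∑-distrib-+ {n} _ _ ⟨
    sumℕ n (λ x → T x · countB n (λ y → not (Q y) ∧ E x y) + W x · countB n (λ y → T y ∧ E x y))
      ≤⟨ ∑-mono-≤ (λ x → either x (∑-mono-≤ λ y → T⊆Q̄ (P y) (Q y) (E x y))) ⟩
    edges P (λ y → not (Q y)) ∎
    where
    -- The complement of `S` is the complement of `Q` together with `W`.
    outside : ∀ p q e → (not (q ∧ not p) ∧ e) · 1 ≤ (not q ∧ e) · 1 + ((p ∧ q) ∧ e) · 1
    outside true  true  e = ≤-refl
    outside true  false e = m≤m+n _ _
    outside false true  e = z≤n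
    outside false false e = m≤m+n _ _

    T⊆Q̄ : ∀ p q e → ((p ∧ not q) ∧ e) · 1 ≤ (not q ∧ e) · 1
    T⊆Q̄ true  q e = ≤-refl
    T⊆Q̄ false q e = z≤n

    ·-distrib-+ : ∀ c {u v} → c · (u + v) ≡ c · u + c · v
    ·-distrib-+ true  = refl
    ·-distrib-+ false = refl

    either : ∀ x {u v} → v ≤ u → T x · u + W x · v ≤ P x · u
    either x v≤u with P x | Q x
    ... | true  | true  = v≤u
    ... | true  | false = ≤-reflexive (+-identityʳ _)
    ... | false | _     = z≤n

-- Half-integral fractional factors

abstract
  half : ℕ → ℚ
  half k = ℤ.+ k / 2

  toℚᵘ-half : ∀ k → toℚᵘ (half k) ℚᵘ.≃ mkℚᵘ (ℤ.+ k) 1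
  toℚᵘ-half k = ℚₚ.toℚᵘ-fromℚᵘ (mkℚᵘ (ℤ.+ k) 1)

  -- Passing to unnormalised fractions makes the denominators explicit and leaves an integer
  -- identity.
  half-+ : ∀ x y → half (x + y) ≡ half x ℚ.+ half y
  half-+ x y = ℚₚ.toℚᵘ-injective (begin
    toℚᵘ (half (x + y))                        ≈⟨ toℚᵘ-half (x + y) ⟩
    mkℚᵘ (ℤ.+ (x + y)) 1                       ≈⟨ *≡* (identity (ℤ.+ x) (ℤ.+ y)) ⟩
    mkℚᵘ (ℤ.+ x) 1 ℚᵘ.+ mkℚᵘ (ℤ.+ y) 1         ≈⟨ ℚᵘₚ.+-cong (toℚᵘ-half x) (toℚᵘ-half y) ⟨
    toℚᵘ (half x) ℚᵘ.+ toℚᵘ (half y)           ≈⟨ ℚₚ.toℚᵘ-homo-+ (half x) (half y) ⟨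
    toℚᵘ (half x ℚ.+ half y)                   ∎)
    where
    open ℚᵘₚ.≃-Reasoning
    identity : ∀ u v → (u ℤ.+ v) ℤ.* ℤ.+ 4 ≡ (u ℤ.* ℤ.+ 2 ℤ.+ v ℤ.* ℤ.+ 2) ℤ.* ℤ.+ 2
    identity = ℤ-Solver.solve-∀

  half-mono-≤ : ∀ {x y} → x ≤ y → half x ℚ.≤ half y
  half-mono-≤ {x} {y} x≤y = ℚₚ.toℚᵘ-cancel-≤ (begin
    toℚᵘ (half x)   ≃⟨ toℚᵘ-half x ⟩
    mkℚᵘ (ℤ.+ x) 1  ≤⟨ *≤* (ℤₚ.*-monoʳ-≤-nonNeg (ℤ.+ 2) (ℤ.+≤+ x≤y)) ⟩
    mkℚᵘ (ℤ.+ y) 1  ≃⟨ toℚᵘ-half y ⟨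
    toℚᵘ (half y)   ∎)
    where open ℚᵘₚ.≤-Reasoning

  half-double : ∀ k → half (k + k) ≡ ℕtoℚ k
  half-double k = ℚₚ.fromℚᵘ-cong {mkℚᵘ (ℤ.+ (k + k)) 1} {mkℚᵘ (ℤ.+ k) 0} (*≡* (identity (ℤ.+ k)))
    where
    identity : ∀ u → (u ℤ.+ u) ℤ.* ℤ.+ 1 ≡ u ℤ.* ℤ.+ 2
    identity = ℤ-Solver.solve-∀

  half-zero : half 0 ≡ 0ℚ
  half-zero = refl

  half-two : half 2 ≡ 1ℚ
  half-two = refl

sumℚ-half : ∀ {n} (u : Fin n → ℕ) (v : Fin n → ℚ) → (∀ i → v i ≡ half (u i)) →
            sumℚ n v ≡ half (sumℕ n u)
sumℚ-half {zero}  u v eq = sym half-zero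
sumℚ-half {suc n} u v eq =
  trans (cong₂ ℚ._+_ (eq zero) (sumℚ-half (u ∘ suc) (v ∘ suc) (eq ∘ suc)))
        (sym (half-+ (u zero) _))

liveEdges : ∀ {n} → (Fin n → Bool) → (Fin n → Fin n → Bool) → Fin n → Fin n → Bool
liveEdges live E x y = live x ∧ live y ∧ E x y

module _ {n : ℕ} (live : Fin n → Bool) (E : Fin n → Fin n → Bool)
         (E-sym : ∀ x y → E x y ≡ E y x) where

  liveEdges-sym : ∀ x y → liveEdges live E x y ≡ liveEdges live E y x
  liveEdges-sym x y rewrite E-sym x y with live x | live y
  ... | true  | true  = refl
  ... | true  | false = refl
  ... | false | true  = refl
  ... | false | false = refl

  -- The degree of `h` at a live `x` is the mean of its row and column sums in the matrix, and both
  -- lie between `g x` and `f x`.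
  fracFactor : ∀ {g f : Fin n → ℕ} → BipartiteFactor (liveEdges live E) (λ x → live x · g x) f →
               FracFactor n live E g f
  fracFactor {g} {f} factor =
    h ,
    (λ i j _ → cong half (+-comm (φ i j · 1) (φ j i · 1))) ,
    (λ i j _ → subst (ℚ._≤ h i j) half-zero (half-mono-≤ z≤n) ,
               subst (h i j ℚ.≤_) half-two
                 (half-mono-≤ (+-mono-≤ (indicator≤1 (φ i j)) (indicator≤1 (φ j i))))) ,
    λ x x-live →
      subst₂ ℚ._≤_ (half-double (g x)) (sym (h-sum x x-live))
        (half-mono-≤ (+-mono-≤ (g≤ x-live (g≤row x)) (g≤ x-live (g≤col x)))) ,
      subst₂ ℚ._≤_ (sym (h-sum x x-live)) (half-double (f x))
        (half-mono-≤ (+-mono-≤ (row≤f upper x) (col≤f upper x)))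
    where
    open BipartiteFactor factor renaming (matrix to φ)
    open UpperFeasible

    h : Fin n → Fin n → ℚ
    h x y = half (φ x y · 1 + φ y x · 1)

    g≤ : ∀ {x k} → live x ≡ true → live x · g x ≤ k → g x ≤ k
    g≤ x-live le rewrite x-live = le

    φ-off : ∀ x y → liveEdges live E x y ≡ false → φ x y ≡ false
    φ-off x y Exy with φ x y in φxy
    ... | false = refl
    ... | true  = contradiction (trans (sym Exy) (below upper x y φxy)) λ ()

    -- Off the live edges both entries of `φ` vanish, so the default value 0 agrees with `h`.
    h-entry : ∀ x y → live x ≡ true → (if live y ∧ E x y then h x y else 0ℚ) ≡ h x y
    h-entry x y x-live with live y ∧ E x y in eq
    ... | true  = refl
    ... | false = trans (sym half-zero) (cong₂ (λ u v → half (u · 1 + v · 1))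
                    (sym (φ-off x y Exy)) (sym (φ-off y x (trans (liveEdges-sym y x) Exy))))
      where
      Exy : liveEdges live E x y ≡ false
      Exy rewrite x-live = eq

    h-sum : ∀ x → live x ≡ true →
      sumℚ n (λ y → if live y ∧ E x y then h x y else 0ℚ) ≡ half (row φ x + col φ x)
    h-sum x x-live =
      trans (sumℚ-half (λ y → φ x y · 1 + φ y x · 1) _ (λ y → h-entry x y x-live))
            (cong half (∑-distrib-+ (λ y → φ x y · 1) (λ y → φ y x · 1)))

-- Arithmetic of a violated cut: s = |S|, p + q = |T|, A = Δ + a, B = b − Δ, N = n − n'

-- Abstract, so that the conversion checker never evaluates the ring-solver proofs it is fed.
abstract
  exceeds : ∀ {l r k} → l ≤ r → l ≡ r + suc k → ⊥
  exceeds {r = r} l≤r refl = <⇒≱ (m<m+n r (s≤s z≤n)) l≤r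

infixl 6 _⊕_
-- The lemmas below are certificates: hypotheses scaled by `⊛` and added by `⊕` give an inequality
-- whose left side exceeds its right side by an explicit positive polynomial.
_⊕_ : ∀ {u v x y} → u ≤ v → x ≤ y → u + x ≤ v + y
_⊕_ = +-mono-≤

infixl 7 _⊛_
_⊛_ : ∀ k {x y} → x ≤ y → k * x ≤ k * y
k ⊛ p = *-monoʳ-≤ k p

-- For t ≤ b the minimum degree gives A s ≥ b B - A e ≥ b (B - e) ≥ t (B - e), against the violated
-- cut.
few-deficient : ∀ A t v s e r → let b = t + v ; B = e + r in
  A ≤ b → A * s + 1 + t * e ≤ t * B → b * B ≤ A * (e + s) → ⊥
few-deficient A t v s e r A≤b h₁ h₂ =
  exceeds (h₁ ⊕ h₂ ⊕ e ⊛ A≤b) (identity A t v s e r)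
  where
  identity : ∀ A t v s e r →
    A * s + 1 + t * e + (t + v) * (e + r) + e * A
    ≡ t * (e + r) + A * (e + s) + e * (t + v) + suc (v * r)
  identity = solve-∀

-- The cut gives A s + c t < 2m. The minimum degree gives A s + A c ≥ A m ≥ 2m, and t ≥ A.
large-d₁ : ∀ A B b m s t c → let d₁ = B + c in
  2 ≤ A → A ≤ b → A ≤ t →
  A * s + 1 + d₁ * t ≤ B * t + 2 * m → A * m + b * B ≤ A * (d₁ + s) → ⊥
large-d₁ A B b m s t c 2≤A A≤b A≤t h₁ h₂ =
  exceeds (h₁ ⊕ h₂ ⊕ B ⊛ A≤b ⊕ c ⊛ A≤t ⊕ m ⊛ 2≤A) (identity A B b m s t c)
  where
  identity : ∀ A B b m s t c →
    A * s + 1 + (B + c) * t + (A * m + b * B) + B * A + c * A + m * 2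
    ≡ B * t + 2 * m + A * (B + c + s) + B * b + c * t + m * A + suc 0
  identity = solve-∀

-- As d₂ ≥ B, only the `p` vertices near `x₁` help the cut: A s < (B - d₁)(d₁ + 1) + 2m ≤ A (B - d₁)
-- + A m. The minimum degree bounds A s from below by the last expression.
large-d₂-large-A : ∀ A b β m s p q d₁ d₂ → let B = d₁ + suc β in
  2 ≤ A → A ≤ b → suc d₁ ≤ A → B ≤ d₂ → p ≤ suc d₁ →
  A * s + 1 + (d₁ * p + d₂ * q) ≤ B * (p + q) + 2 * m →
  A * m + b * B ≤ A * (d₁ + s) → ⊥
large-d₂-large-A A b β m s p q d₁ d₂ 2≤A A≤b d₁<A B≤d₂ p≤ h₁ h₂ =
  exceeds
    (h₁ ⊕ h₂ ⊕ q ⊛ B≤d₂ ⊕ suc β ⊛ p≤ ⊕ (d₁ + suc β) ⊛ A≤b ⊕ m ⊛ 2≤A ⊕ suc β ⊛ d₁<A)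
    (identity A b β m s p q d₁ d₂)
  where
  identity : ∀ A b β m s p q d₁ d₂ →
    A * s + 1 + (d₁ * p + d₂ * q) + (A * m + b * (d₁ + suc β)) + q * (d₁ + suc β)
      + suc β * p + (d₁ + suc β) * A + m * 2 + suc β * suc d₁
    ≡ (d₁ + suc β) * (p + q) + 2 * m + A * (d₁ + s) + q * d₂ + suc β * suc d₁
      + (d₁ + suc β) * b + m * A + suc β * A + suc 0
  identity = solve-∀

-- `key` gives A s ≥ B K - A d₂, while the cut gives A s < (B - d₁)(d₁ + 1) - c + 2m; A ≤ d₁ and c <
-- m make these incompatible.
large-d₂-small-A : ∀ A β s p q N d₁ c μ →
  let B = d₁ + suc β ; d₂ = B + c ; m = suc c + μ in
  A ≤ d₁ → 1 ≤ c → 1 ≤ q → p ≤ suc d₁ →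
  A * s + 1 + (d₁ * p + d₂ * q) ≤ B * (p + q) + 2 * m →
  B * N ≤ (A + B) * (d₂ + s) →
  (A + B) * (A + (d₁ + β) + 2 * m) < A * N → ⊥
large-d₂-small-A A β s p q N d₁ c μ A≤d₁ 1≤c 1≤q p≤ h₁ h₂ h₃ =
  exceeds (h₁ ⊕ key ⊕ c ⊛ 1≤q ⊕ suc β ⊛ p≤ ⊕ c ⊛ A≤d₁ ⊕ 1≤c)
    (identity A β s p q d₁ c μ)
  where
  B = d₁ + suc β
  K = A + (d₁ + β) + 2 * (suc c + μ)

  open ≤-Reasoning

  -- `N` is eliminated between `B` times the order condition and `A` times the degree condition;
  -- then the factor A + B cancels.
  key : B * K ≤ A * (B + c + s)
  key = *-cancelˡ-≤ (A + B) {{>-nonZero (≤-trans (≤-trans (s≤s z≤n) (m≤n+m (suc β) d₁)) (m≤n+m B A))}} (begin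
    (A + B) * (B * K)         ≡⟨ rearrange₁ (A + B) B K ⟩
    B * ((A + B) * K)         ≤⟨ B ⊛ <⇒≤ h₃ ⟩
    B * (A * N)               ≡⟨ rearrange₁ B A N ⟩
    A * (B * N)               ≤⟨ A ⊛ h₂ ⟩
    A * ((A + B) * (B + c + s)) ≡⟨ rearrange₁ A (A + B) (B + c + s) ⟩
    (A + B) * (A * (B + c + s)) ∎)
    where
    rearrange₁ : ∀ x y z → x * (y * z) ≡ y * (x * z)
    rearrange₁ = solve-∀

  identity : ∀ A β s p q d₁ c μ →
    A * s + 1 + (d₁ * p + (d₁ + suc β + c) * q)
      + (d₁ + suc β) * (A + (d₁ + β) + 2 * (suc c + μ))
      + c * 1 + suc β * p + c * A + 1
    ≡ (d₁ + suc β) * (p + q) + 2 * (suc c + μ) + A * (d₁ + suc β + c + s)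
      + c * q + suc β * suc d₁ + c * d₁ + c
      + suc (d₁ * d₁ + d₁ * β + β * β + 2 * (1 + μ) * (d₁ + β) + c * d₁ + 2 * (c * β))
  identity = solve-∀

-- The case d₂ = 0, where (A + B) s ≥ B N ≥ B s + B t > B s + A s.
isolated : ∀ A B s t N → A * s + 1 ≤ B * t → s + t ≤ N → B * N ≤ (A + B) * s → ⊥
isolated A B s t N h₁ h₂ h₃ =
  exceeds (h₁ ⊕ B ⊛ h₂ ⊕ h₃) (identity A B s t N)
  where
  identity : ∀ A B s t N →
    A * s + 1 + B * (s + t) + B * N ≡ B * t + B * N + (A + B) * s + suc 0
  identity = solve-∀

-- Eliminating `s` gives A d₂ N < (A + B)((A + B - d₂) d₂ + 2m). Since d₂ ≥ 1, the order condition
-- multiplied by d₂ contradicts this.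
small-d₂-equal : ∀ A d r m s p q N → let d₂ = suc d ; B = d₂ + r in
   A * s + 1 + (d₂ * p + d₂ * q) ≤ B * (p + q) + 2 * m →
   s + (p + q) ≤ N → B * N ≤ (A + B) * (d₂ + s) →
   (A + B) * (A + (d + r) + 2 * m) < A * N → ⊥
small-d₂-equal A d r m s p q N h₁ h₂ h₃ h₄ =
  exceeds ((A + B) ⊛ (h₁ ⊕ r ⊛ h₂) ⊕ (A + r) ⊛ h₃ ⊕ suc d ⊛ h₄)
   (identity A d r m s p q N)
  where
  B = suc d + r
  identity : ∀ A d r m s p q N →
    (A + (suc d + r)) * (A * s + 1 + (suc d * p + suc d * q) + r * (s + (p + q)))
      + (A + r) * ((suc d + r) * N) + suc d * suc ((A + (suc d + r)) * (A + (d + r) + 2 * m))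
    ≡ (A + (suc d + r)) * ((suc d + r) * (p + q) + 2 * m + r * N)
      + (A + r) * ((A + (suc d + r)) * (suc d + s)) + suc d * (A * N)
      + suc ((A + (suc d + r)) * (1 + (1 + d) * d + 2 * m * d) + d)
  identity = solve-∀

-- The same elimination; the vertices near `x₁` add (d₂ - d₁)(d₁ + 1) to the upper bound, which the
-- term d₂ (d₂ - 1) from the order condition absorbs.
small-d₂-greater : ∀ A d₁ k r m s p q N → let d₂ = d₁ + suc k ; B = d₂ + r in
   p ≤ suc d₁ →
   A * s + 1 + (d₁ * p + d₂ * q) ≤ B * (p + q) + 2 * m →
   s + (p + q) ≤ N → B * N ≤ (A + B) * (d₂ + s) →
   (A + B) * (A + (d₁ + k + r) + 2 * m) < A * N → ⊥
small-d₂-greater A d₁ k r m s p q N p≤ h₁ h₂ h₃ h₄ =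
  exceeds ((A + B) ⊛ (h₁ ⊕ r ⊛ h₂ ⊕ suc k ⊛ p≤) ⊕ (A + r) ⊛ h₃ ⊕ (d₁ + suc k) ⊛ h₄)
   (identity A d₁ k r m s p q N)
  where
  B = d₁ + suc k + r
  identity : ∀ A d₁ k r m s p q N →
    (A + (d₁ + suc k + r)) * (A * s + 1 + (d₁ * p + (d₁ + suc k) * q) + r * (s + (p + q)) + suc k * p)
      + (A + r) * ((d₁ + suc k + r) * N)
      + (d₁ + suc k) * suc ((A + (d₁ + suc k + r)) * (A + (d₁ + k + r) + 2 * m))
    ≡ (A + (d₁ + suc k + r)) * ((d₁ + suc k + r) * (p + q) + 2 * m + r * N + suc k * suc d₁)
      + (A + r) * ((A + (d₁ + suc k + r)) * (d₁ + suc k + s)) + (d₁ + suc k) * (A * N)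
      + suc ((A + (d₁ + suc k + r)) * (d₁ * d₁ + k * k + d₁ * k + 2 * m * (d₁ + k)) + (d₁ + k))
  identity = solve-∀

≤⇒∃+ : ∀ {x y} → x ≤ y → ∃ λ k → y ≡ x + k
≤⇒∃+ x≤y = let k , eq = m≤n⇒∃[o]m+o≡n x≤y in k , sym eq

<⇒∃+suc : ∀ {x y} → x < y → ∃ λ k → y ≡ x + suc k
<⇒∃+suc {x} x<y = let k , eq = m≤n⇒∃[o]m+o≡n x<y in k , trans (sym eq) (sym (+-suc x k))

K≡A+B∸1+y : ∀ {K} A {B} x y → suc K ≡ A + B + y → B ≡ suc x → K ≡ A + x + y
K≡A+B∸1+y A x y K≡ refl = suc-injective (trans K≡ (cong (_+ y) (+-suc A x)))

-- For d₁ < A the minimum degree decides. For A ≤ d₁ the degree condition does, with the excess d₂ -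
-- B kept below `m`.
large-d₂ : ∀ A B K b m s p q N d₁ d₂ →
  2 ≤ A → A ≤ b → suc K ≡ A + B + 2 * m → (A + B) * K < A * N →
  d₁ < B → B < d₂ → d₂ < B + m → p ≤ suc d₁ → 1 ≤ q →
  A * s + 1 + (d₁ * p + d₂ * q) ≤ B * (p + q) + 2 * m →
  A * m + b * B ≤ A * (d₁ + s) →
  B * N ≤ (A + B) * (d₂ + s) → ⊥
large-d₂ A B K b m s p q N d₁ d₂ 2≤A A≤b K≡ N> d₁<B B<d₂ d₂< p≤ 1≤q sum δ₁ δ₂
  with <⇒∃+suc d₁<B | suc d₁ ≤? A
... | β , refl | yes d₁<A =
  large-d₂-large-A A b β m s p q d₁ d₂ 2≤A A≤b d₁<A (<⇒≤ B<d₂) p≤ sum δ₁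
... | β , refl | no d₁≮A with <⇒∃+suc B<d₂
...   | c , refl with ≤⇒∃+ (+-cancelˡ-< (d₁ + suc β) (suc c) m d₂<)
...     | μ , refl =
  large-d₂-small-A A β s p q N d₁ (suc c) μ (≮⇒≥ d₁≮A) (s≤s z≤n) 1≤q p≤ sum δ₂
    (subst (λ k → (A + (d₁ + suc β)) * k < A * N)
      (K≡A+B∸1+y A (d₁ + β) _ K≡ (+-suc d₁ β)) N>)

-- The order condition enters multiplied by `d₂`, so for d₂ = 0 it cannot absorb the 2m of `sum′`;
-- there `sum`, which comes from the degrees in G - U - S - H, takes its place.
small-d₂ : ∀ A B K m s p q N d₁ d₂ →
  suc K ≡ A + B + 2 * m → (A + B) * K < A * N →
  d₁ ≤ d₂ → d₂ ≤ B → p ≤ suc d₁ → s + (p + q) ≤ N →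
  A * s + 1 ≤ B * (p + q) →
  A * s + 1 + (d₁ * p + d₂ * q) ≤ B * (p + q) + 2 * m →
  B * N ≤ (A + B) * (d₂ + s) → ⊥
small-d₂ A B K m s p q N d₁ d₂ K≡ N> d₁≤d₂ d₂≤B p≤ size sum sum′ δ₂
  with m≤n⇒m<n∨m≡n d₁≤d₂ | ≤⇒∃+ d₂≤B
small-d₂ A B K m s p q N zero _ K≡ N> d₁≤d₂ d₂≤B p≤ size sum sum′ δ₂
    | inj₂ refl | _ = isolated A B s (p + q) N sum size δ₂
small-d₂ A _ K m s p q N (suc d) _ K≡ N> d₁≤d₂ d₂≤B p≤ size sum sum′ δ₂
    | inj₂ refl | r , refl =
  small-d₂-equal A d r m s p q N sum′ size δ₂
    (subst (λ k → (A + (suc d + r)) * k < A * N)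
      (K≡A+B∸1+y A (d + r) (2 * m) K≡ refl) N>)
small-d₂ A _ K m s p q N d₁ _ K≡ N> d₁≤d₂ d₂≤B p≤ size sum sum′ δ₂
    | inj₁ d₁<d₂ | r , refl with <⇒∃+suc d₁<d₂
... | k , refl =
  small-d₂-greater A d₁ k r m s p q N p≤ sum′ size δ₂
    (subst (λ k′ → (A + (d₁ + suc k + r)) * k′ < A * N)
      (K≡A+B∸1+y A (d₁ + k + r) (2 * m) K≡ (cong (_+ r) (+-suc d₁ k))) N>)

-- Degrees after deleting U, H and S

∣U∣≡countB : ∀ {n} (U : Subset n) → ∣ U ∣ ≡ countB n (inSet U)
∣U∣≡countB []          = refl
∣U∣≡countB (true ∷ U)  = cong suc (∣U∣≡countB U)
∣U∣≡countB (false ∷ U) = ∣U∣≡countB U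

countB-live : ∀ {n} (U : Subset n) → countB n (liveOut U) + ∣ U ∣ ≡ n
countB-live {n} U = begin
  countB n (liveOut U) + ∣ U ∣               ≡⟨ cong (countB n (liveOut U) +_) (∣U∣≡countB U) ⟩
  countB n (liveOut U) + countB n (inSet U)  ≡⟨ ∑-distrib-+ {n} _ _ ⟨
  sumℕ n (λ x → liveOut U x · 1 + inSet U x · 1) ≡⟨ ∑-cong (λ x → one (inSet U x)) ⟩
  sumℕ n (λ _ → 1)                           ≡⟨ ∑-const n 1 ⟩
  n * 1                                      ≡⟨ *-identityʳ n ⟩
  n                                          ∎
  where
  open ≡-Reasoning
  one : ∀ c → not c · 1 + c · 1 ≡ 1
  one true  = refl
  one false = refl

module _ {n : ℕ} (G : Graph n) (U : Subset n) (H : Fin n → Fin n → Bool)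
         (H-edges : IsEdgeSetOf G U H) where

  private
    H-sym : ∀ x y → H x y ≡ H y x
    H-sym = proj₁ H-edges

    H-irrefl : ∀ x → H x x ≡ false
    H-irrefl x with H x x in Hxx
    ... | false = refl
    ... | true  = contradiction (trans (sym (irrefl G x)) (proj₁ (proj₂ H-edges x x Hxx))) λ ()

  remainingEdges : Fin n → Fin n → Bool
  remainingEdges x y = adj G x y ∧ not (H x y)

  remainingEdges-sym : ∀ x y → remainingEdges x y ≡ remainingEdges y x
  remainingEdges-sym x y = cong₂ (λ u v → u ∧ not v) (adj-sym G x y) (H-sym x y)

  -- `edgeCount` sees each edge from its smaller end. The diagonal is empty, so every entry of `H`
  -- is counted by `up` in one of the two orders.
  ∑-row-H : sumℕ n (row H) ≤ 2 * edgeCount n H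
  ∑-row-H = begin
    sumℕ n (row H)
      ≤⟨ ∑-mono-≤ (λ x → ≤-trans (∑-mono-≤ (oriented x)) (≤-reflexive (∑-distrib-+ {n} _ _))) ⟩
    sumℕ n (λ x → countB n (λ y → up x y) + countB n (λ y → up y x))
      ≡⟨ ∑-distrib-+ {n} _ _ ⟩
    edgeCount n H + sumℕ n (λ x → countB n (λ y → up y x))
      ≡⟨ cong (edgeCount n H +_) (∑-comm (λ x y → up y x · 1)) ⟩
    edgeCount n H + edgeCount n H
      ≡⟨ cong (edgeCount n H +_) (+-identityʳ _) ⟨
    2 * edgeCount n H ∎
    where
    open ≤-Reasoning

    up : Fin n → Fin n → Bool
    up x y = (toℕ x <ᵇ toℕ y) ∧ H x y

    up-< : ∀ x y → toℕ x < toℕ y → H x y ≡ true → up x y ≡ true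
    up-< x y x<y Hxy with toℕ x <ᵇ toℕ y | <⇒<ᵇ x<y
    ... | true | _ = Hxy

    oriented : ∀ x y → H x y · 1 ≤ up x y · 1 + up y x · 1
    oriented x y with H x y Boolₚ.≟ true
    ... | no ¬H rewrite Boolₚ.¬-not ¬H = z≤n
    ... | yes Hxy with <-cmp (toℕ x) (toℕ y)
    ...   | tri< x<y _ _ rewrite up-< x y x<y Hxy | Hxy = s≤s z≤n
    ...   | tri> _ _ y<x rewrite up-< y x y<x (trans (H-sym y x) Hxy) | Hxy = m≤n+m 1 _
    ...   | tri≈ _ x≡y _ with Finₚ.toℕ-injective x≡y
    ...     | refl = contradiction (trans (sym (H-irrefl x)) Hxy) λ ()

  -- Row and column of `x` are equal by symmetry and share no entry because the diagonal is empty,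
  -- so together they are at most the total of `H`.
  row-H : ∀ x → row H x ≤ edgeCount n H
  row-H x = *-cancelˡ-≤ 2 (begin
    2 * row H x                             ≡⟨ cong (row H x +_) (+-identityʳ _) ⟩
    row H x + row H x                       ≡⟨ cong (_+ row H x) (∑-cong λ i → cong (_· 1) (H-sym x i)) ⟩
    col H x + row H x                       ≤⟨ ∑-exchange x (λ i _ → term≤∑ (λ y → H i y · 1) x) at ⟩
    sumℕ n (row H) + 0                      ≡⟨ +-identityʳ _ ⟩
    sumℕ n (row H)                          ≤⟨ ∑-row-H ⟩
    2 * edgeCount n H                       ∎)
    where
    open ≤-Reasoning
    at : H x x · 1 + row H x ≤ row H x + 0
    at rewrite H-irrefl x = ≤-reflexive (sym (+-identityʳ _))

  module _ (S : Fin n → Bool) where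

    -- The cut ranges over all vertices of `G`, so `S` may meet `U`; only its live part is counted.
    size-S : ℕ
    size-S = countB n (λ x → S x ∧ liveOut U x)

    -- d and e are the degrees in G − U − S and in G − U − S − H.
    d e : Fin n → ℕ
    d x = countB n (λ y → liveOut U y ∧ not (S y) ∧ adj G x y)
    e x = countB n (λ y → not (S y) ∧ liveEdges (liveOut U) remainingEdges x y)

    deg≤ : ∀ x → deg G x ≤ ∣ U ∣ + (d x + size-S)
    deg≤ x = begin
      deg G x
        ≤⟨ ∑-mono-≤ (λ y → pointwise (inSet U y) (S y) (adj G x y)) ⟩
      sumℕ n (λ y → inSet U y · 1 + ((liveOut U y ∧ not (S y) ∧ adj G x y) · 1 + (S y ∧ liveOut U y) · 1))
        ≡⟨ ∑-distrib-+ {n} _ _ ⟩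
      countB n (inSet U) + sumℕ n (λ y → (liveOut U y ∧ not (S y) ∧ adj G x y) · 1 + (S y ∧ liveOut U y) · 1)
        ≡⟨ cong₂ _+_ (sym (∣U∣≡countB U)) (∑-distrib-+ {n} _ _) ⟩
      ∣ U ∣ + (d x + size-S) ∎
      where
      open ≤-Reasoning
      pointwise : ∀ u s a → a · 1 ≤ u · 1 + ((not u ∧ not s ∧ a) · 1 + (s ∧ not u) · 1)
      pointwise true  s     true  = s≤s z≤n
      pointwise false true  true  = ≤-refl
      pointwise false false true  = ≤-refl
      pointwise _     _     false = z≤n

    d≤e+row-H : ∀ x → liveOut U x ≡ true → d x ≤ e x + row H x
    d≤e+row-H x x-live = subst (d x ≤_) (∑-distrib-+ {n} _ _) (∑-mono-≤ pointwise)
      where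
      pointwise : ∀ y → (liveOut U y ∧ not (S y) ∧ adj G x y) · 1 ≤
        (not (S y) ∧ liveEdges (liveOut U) remainingEdges x y) · 1 + H x y · 1
      pointwise y rewrite x-live with liveOut U y | S y | adj G x y | H x y
      ... | true  | true  | _     | _     = z≤n
      ... | true  | false | true  | true  = ≤-refl
      ... | true  | false | true  | false = ≤-refl
      ... | true  | false | false | _     = z≤n
      ... | false | _     | _     | _     = z≤n

    -- Excluding a violated cut.

    module _ (T : Fin n → Bool)
             (T-live : ∀ x → T x ≡ true → liveOut U x ≡ true)
             (T∩S : ∀ x → T x ≡ true → S x ≡ false)
             (A B b K : ℕ) (2≤A : 2 ≤ A) (A≤b : A ≤ b) (B≤b : B ≤ b)
             (K≡ : suc K ≡ A + B + 2 * edgeCount n H)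
             (order : (A + B) * K < A * countB n (liveOut U))
             (δ : ∀ x → A * edgeCount n H + b * B ≤ A * (d x + size-S))
             (ore : ∀ x y → x ≢ y → adj G x y ≡ false →
                    B * countB n (liveOut U) ≤ (A + B) * ((d x ⊔ d y) + size-S))
             (e<B : ∀ x → T x ≡ true → e x < B)
             (violated : A * size-S + 1 ≤ sumℕ n (λ x → T x · (B ∸ e x)))
             where

      private
        m s t N : ℕ
        m = edgeCount n H
        s = size-S
        t = countB n T
        N = countB n (liveOut U)

        open ≤-Reasoning

        size : s + t ≤ N
        size = subst (_≤ N) (∑-distrib-+ {n} _ _) (∑-mono-≤ pointwise)
          where
          pointwise : ∀ x → (S x ∧ liveOut U x) · 1 + T x · 1 ≤ liveOut U x · 1
          pointwise x with T x in Tx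
          ... | true rewrite T∩S x Tx | T-live x Tx = ≤-refl
          ... | false with S x | liveOut U x
          ...   | true  | true  = ≤-refl
          ...   | true  | false = z≤n
          ...   | false | _     = z≤n

        d≤e+m : ∀ x → T x ≡ true → d x ≤ e x + m
        d≤e+m x Tx = ≤-trans (d≤e+row-H x (T-live x Tx)) (+-monoʳ-≤ (e x) (row-H x))

        sum-e : ∀ c → (∀ x → T x ≡ true → c ≤ e x) → A * s + 1 + c * t ≤ B * t
        sum-e c c≤e = begin
          A * s + 1 + c * t
            ≤⟨ +-mono-≤ violated (≤-reflexive (sym (∑-distribˡ-* c (λ x → T x · 1)))) ⟩
          sumℕ n (λ x → T x · (B ∸ e x)) + sumℕ n (λ x → c * T x · 1)
            ≡⟨ ∑-distrib-+ {n} _ _ ⟨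
          sumℕ n (λ x → T x · (B ∸ e x) + c * T x · 1)
            ≤⟨ ∑-mono-≤ pointwise ⟩
          sumℕ n (λ x → B * T x · 1)
            ≡⟨ ∑-distribˡ-* B (λ x → T x · 1) ⟩
          B * t ∎
          where
          pointwise : ∀ x → T x · (B ∸ e x) + c * T x · 1 ≤ B * T x · 1
          pointwise x with T x in Tx
          ... | false rewrite *-zeroʳ c = z≤n
          ... | true rewrite *-identityʳ c | *-identityʳ B =
            ≤-trans (+-monoʳ-≤ (B ∸ e x) (c≤e x Tx)) (≤-reflexive (m∸n+n≡m (<⇒≤ (e<B x Tx))))

        -- Replacing `e` by `d` costs `row H x` at each vertex of `T`, at most 2m in all. The
        -- additive form avoids `B ∸ d x`, which is truncated where `d x` exceeds `B`.
        sum-d : A * s + 1 + sumℕ n (λ x → T x · d x) ≤ B * t + 2 * m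
        sum-d = begin
          A * s + 1 + sumℕ n (λ x → T x · d x)
            ≤⟨ +-monoˡ-≤ _ violated ⟩
          sumℕ n (λ x → T x · (B ∸ e x)) + sumℕ n (λ x → T x · d x)
            ≡⟨ ∑-distrib-+ {n} _ _ ⟨
          sumℕ n (λ x → T x · (B ∸ e x) + T x · d x)
            ≤⟨ ∑-mono-≤ pointwise ⟩
          sumℕ n (λ x → B * T x · 1 + row H x)
            ≡⟨ ∑-distrib-+ {n} _ _ ⟩
          sumℕ n (λ x → B * T x · 1) + sumℕ n (row H)
            ≤⟨ +-mono-≤ (≤-reflexive (∑-distribˡ-* B (λ x → T x · 1))) ∑-row-H ⟩
          B * t + 2 * m ∎
          where
          pointwise : ∀ x → T x · (B ∸ e x) + T x · d x ≤ B * T x · 1 + row H x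
          pointwise x with T x in Tx
          ... | false = z≤n
          ... | true rewrite *-identityʳ B = begin
            B ∸ e x + d x               ≤⟨ +-monoʳ-≤ (B ∸ e x) (d≤e+row-H x (T-live x Tx)) ⟩
            B ∸ e x + (e x + row H x)   ≡⟨ +-assoc (B ∸ e x) (e x) (row H x) ⟨
            B ∸ e x + e x + row H x     ≡⟨ cong (_+ row H x) (m∸n+n≡m (<⇒≤ (e<B x Tx))) ⟩
            B + row H x                 ∎

        nonempty : ¬ (∀ x → T x ≡ false)
        nonempty none = contradiction (≤-trans (m≤n+m 1 (A * s)) (≤-trans violated (≤-reflexive
          (trans (∑-cong λ x → cong (_· (B ∸ e x)) (none x)) (∑-zero n))))) λ ()

        many : b < t
        many with t ≤? b | argmin T e
        ... | no t≰b  | _         = ≰⇒> t≰b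
        ... | yes _   | inj₁ none = contradiction none nonempty
        ... | yes t≤b | inj₂ (x , Tx , least) =
          let v , b≡ = ≤⇒∃+ t≤b
              r , B≡ = ≤⇒∃+ (<⇒≤ (e<B x Tx))
          in ⊥-elim (few-deficient A t v s (e x) r (subst (A ≤_) b≡ A≤b)
               (subst₂ _≤_ (cong (A * s + 1 +_) (*-comm (e x) t))
                  (trans (*-comm B t) (cong (t *_) B≡)) (sum-e (e x) least))
               (subst₂ (λ u w → u * w ≤ A * (e x + s)) b≡ B≡ δ-e))
          where
          -- The summand A m of the minimum degree bound pays for the edges of `H` at `x`.
          δ-e : b * B ≤ A * (e x + s)
          δ-e = +-cancelˡ-≤ (A * m) _ _ (begin
            A * m + b * B           ≤⟨ δ x ⟩
            A * (d x + s)           ≤⟨ *-monoʳ-≤ A (+-monoˡ-≤ s (d≤e+m x Tx)) ⟩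
            A * (e x + m + s)       ≡⟨ identity A (e x) m s ⟩
            A * m + A * (e x + s)   ∎)
            where
            identity : ∀ A e m s → A * (e + m + s) ≡ A * m + A * (e + s)
            identity = solve-∀

        module _ (x₁ : Fin n) (least₁ : ∀ x → T x ≡ true → d x₁ ≤ d x) where

          d₁<B : d x₁ < B
          d₁<B with d x₁ <? B
          ... | yes lt = lt
          ... | no d₁≮B =
            let c , d₁≡ = ≤⇒∃+ (≮⇒≥ d₁≮B) in
            ⊥-elim (large-d₁ A B b m s t c 2≤A A≤b (≤-trans A≤b (<⇒≤ many))
              (subst (λ k → A * s + 1 + k * t ≤ B * t + 2 * m) d₁≡
                (≤-trans (+-monoʳ-≤ (A * s + 1) d₁t≤) sum-d))
              (subst (λ k → A * m + b * B ≤ A * (k + s)) d₁≡ (δ x₁)))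
            where
            pointwise : ∀ x → d x₁ * T x · 1 ≤ T x · d x
            pointwise x with T x in Tx
            ... | false = ≤-reflexive (*-zeroʳ (d x₁))
            ... | true  = ≤-trans (≤-reflexive (*-identityʳ (d x₁))) (least₁ x Tx)

            d₁t≤ : d x₁ * t ≤ sumℕ n (λ x → T x · d x)
            d₁t≤ = ≤-trans (≤-reflexive (sym (∑-distribˡ-* (d x₁) (λ x → T x · 1))))
                           (∑-mono-≤ pointwise)

          near : Fin n → Bool
          near x = ⌊ x ≟ x₁ ⌋ ∨ adj G x₁ x

          p q : ℕ
          p = countB n (λ x → T x ∧ near x)
          q = countB n (λ x → T x ∧ not (near x))

          t≡p+q : t ≡ p + q
          t≡p+q = trans (∑-cong λ x → pointwise (T x) (near x)) (∑-distrib-+ {n} _ _)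
            where
            pointwise : ∀ u v → u · 1 ≡ (u ∧ v) · 1 + (u ∧ not v) · 1
            pointwise true  true  = refl
            pointwise true  false = refl
            pointwise false _     = refl

          -- `T` is live and avoids `S`, so its neighbours of `x₁` are counted by `d x₁`; the extra
          -- one is for `x₁` itself.
          p≤ : p ≤ suc (d x₁)
          p≤ = subst₂ _≤_ (+-identityʳ p) (+-comm (d x₁) 1)
            (∑-exchange {c = 0} {1} x₁ off (≤-trans (≤-reflexive (+-identityʳ _))
              (≤-trans (indicator≤1 (T x₁ ∧ near x₁)) (m≤n+m 1 _))))
            where
            off : ∀ x → x ≢ x₁ →
              (T x ∧ near x) · 1 ≤ (liveOut U x ∧ not (S x) ∧ adj G x₁ x) · 1
            off x x≢x₁ with T x in Tx | x ≟ x₁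
            ... | false | _        = z≤n
            ... | true  | yes x≡x₁ = contradiction x≡x₁ x≢x₁
            ... | true  | no _ rewrite T-live x Tx | T∩S x Tx = ≤-refl

          1≤q : 1 ≤ q
          1≤q with 1 ≤? q
          ... | yes le = le
          ... | no 1≰q = contradiction (begin-strict
            t          ≡⟨ t≡p+q ⟩
            p + q      ≡⟨ cong (p +_) (n<1⇒n≡0 (≰⇒> 1≰q)) ⟩
            p + 0      ≡⟨ +-identityʳ p ⟩
            p          ≤⟨ p≤ ⟩
            suc (d x₁) ≤⟨ d₁<B ⟩
            B          ≤⟨ B≤b ⟩
            b          <⟨ many ⟩
            t          ∎) (<-irrefl refl)

          module _ (x₂ : Fin n) (Tx₂ : (T x₂ ∧ not (near x₂)) ≡ true)
                   (least₂ : ∀ x → (T x ∧ not (near x)) ≡ true → d x₂ ≤ d x) where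

            T-far : ∀ x → (T x ∧ not (near x)) ≡ true → T x ≡ true × x₁ ≢ x × adj G x₁ x ≡ false
            T-far x far with T x | x ≟ x₁ | adj G x₁ x
            ... | true | no x≢x₁ | false = refl , x≢x₁ ∘ sym , refl

            d₁≤d₂ : d x₁ ≤ d x₂
            d₁≤d₂ = least₁ x₂ (proj₁ (T-far x₂ Tx₂))

            sum′ : A * s + 1 + (d x₁ * p + d x₂ * q) ≤ B * (p + q) + 2 * m
            sum′ = begin
              A * s + 1 + (d x₁ * p + d x₂ * q)
                ≤⟨ +-monoʳ-≤ (A * s + 1) split ⟩
              A * s + 1 + sumℕ n (λ x → T x · d x)
                ≤⟨ sum-d ⟩
              B * t + 2 * m
                ≡⟨ cong (λ k → B * k + 2 * m) t≡p+q ⟩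
              B * (p + q) + 2 * m ∎
              where
              pointwise : ∀ x → d x₁ * (T x ∧ near x) · 1 + d x₂ * (T x ∧ not (near x)) · 1 ≤ T x · d x
              pointwise x with T x in Tx | near x in nearx
              ... | true | true rewrite *-identityʳ (d x₁) | *-zeroʳ (d x₂) | +-identityʳ (d x₁) =
                least₁ x Tx
              ... | true | false rewrite *-identityʳ (d x₂) | *-zeroʳ (d x₁) =
                least₂ x (cong₂ (λ u v → u ∧ not v) Tx nearx)
              ... | false | _ rewrite *-zeroʳ (d x₁) | *-zeroʳ (d x₂) = z≤n

              split : d x₁ * p + d x₂ * q ≤ sumℕ n (λ x → T x · d x)
              split = begin
                d x₁ * p + d x₂ * q
                  ≡⟨ cong₂ _+_ (∑-distribˡ-* {n} (d x₁) _) (∑-distribˡ-* {n} (d x₂) _) ⟨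
                sumℕ n (λ x → d x₁ * (T x ∧ near x) · 1) + sumℕ n (λ x → d x₂ * (T x ∧ not (near x)) · 1)
                  ≡⟨ ∑-distrib-+ {n} _ _ ⟨
                sumℕ n (λ x → d x₁ * (T x ∧ near x) · 1 + d x₂ * (T x ∧ not (near x)) · 1)
                  ≤⟨ ∑-mono-≤ pointwise ⟩
                sumℕ n (λ x → T x · d x) ∎

            ore′ : B * N ≤ (A + B) * (d x₂ + s)
            ore′ = let _ , x₁≢x₂ , nonadj = T-far x₂ Tx₂ in
              subst (λ k → B * N ≤ (A + B) * (k + s)) (m≤n⇒m⊔n≡n d₁≤d₂) (ore x₁ x₂ x₁≢x₂ nonadj)

            absurd : ⊥
            absurd with d x₂ ≤? B
            ... | yes d₂≤B = small-d₂ A B K m s p q N (d x₁) (d x₂) K≡ order d₁≤d₂ d₂≤B p≤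
              (subst (λ k → s + k ≤ N) t≡p+q size)
              (subst (λ k → A * s + 1 ≤ B * k) t≡p+q
                (subst (_≤ B * t) (+-identityʳ _) (sum-e 0 λ _ _ → z≤n)))
              sum′ ore′
            ... | no d₂≰B = large-d₂ A B K b m s p q N (d x₁) (d x₂) 2≤A A≤b K≡ order d₁<B (≰⇒> d₂≰B)
              -- At most `m` edges of `H` meet `x₂`, so d x₂ ≤ e x₂ + m < B + m.
              (≤-<-trans (d≤e+m x₂ (proj₁ (T-far x₂ Tx₂)))
                         (+-monoˡ-< m (e<B x₂ (proj₁ (T-far x₂ Tx₂)))))
              p≤ 1≤q sum′ (δ x₁) ore′

      no-violation : ⊥
      no-violation with argmin T d
      ... | inj₁ none = nonempty none
      ... | inj₂ (x₁ , _ , least₁)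
          with argmin (λ x → T x ∧ not (near x₁ least₁ x)) d
      ...   | inj₂ (x₂ , Tx₂ , least₂) = absurd x₁ least₁ x₂ Tx₂ least₂
      ...   | inj₁ none = contradiction (≤-trans (1≤q x₁ least₁) (≤-reflexive
              (trans (∑-cong λ x → cong (_· 1) (none x)) (∑-zero n)))) λ ()

-- Transfer of the hypotheses to G - U - S.

theorem2 : (n : ℕ) (G : Graph n) (b a n' m Δ : ℕ)
    → a ≤ b ∸ Δ → 2 ≤ a
    → (∀ x → (Δ + a) * (m + n') + b * (b ∸ Δ) ≤ (Δ + a) * deg G x)
    → ((b + a + 2 * m) ∸ 1) * (a + b) + (Δ + a) * n' < (Δ + a) * n
    → (g f : Fin n → ℕ)
    → (∀ x → (f x ∸ Δ ≤ b ∸ Δ) × (g x ≤ f x ∸ Δ) × (a ≤ g x))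
    → (∀ x y → x ≢ y → adj G x y ≡ false →
    (b ∸ Δ) * n + (Δ + a) * n' ≤ (b + a) * (deg G x ⊔ deg G y))
    → FracCriticalDeleted G g f n' m
theorem2 n G b a n' m Δ a≤b∸Δ 2≤a δ order g f bounds ore U refl H H-edges refl =
  fracFactor live E E-sym
    (bipartiteFactor (liveEdges live E) (liveEdges-sym live E E-sym) gˡ f gˡ≤f
      (uncross (liveEdges live E) gˡ f (liveEdges-sym live E E-sym) gˡ≤f disjoint))
  where
  open ≤-Reasoning

  live : Fin n → Bool
  live = liveOut U

  E : Fin n → Fin n → Bool
  E = remainingEdges G U H H-edges

  E-sym : ∀ x y → E x y ≡ E y x
  E-sym = remainingEdges-sym G U H H-edges

  A B K N : ℕ
  A = Δ + a
  B = b ∸ Δ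
  K = (b + a + 2 * m) ∸ 1
  N = countB n live

  -- `b ∸ Δ` is at least 2, so this subtraction is not truncated; the same argument serves `f x ∸ Δ`
  -- below.
  Δ≤b : Δ ≤ b
  Δ≤b with Δ ≤? b
  ... | yes le = le
  ... | no Δ≰b = contradiction
    (≤-trans (≤-trans 2≤a a≤b∸Δ) (≤-reflexive (m≤n⇒m∸n≡0 (<⇒≤ (≰⇒> Δ≰b))))) λ ()

  b+a≡A+B : b + a ≡ A + B
  b+a≡A+B = trans (cong (_+ a) (sym (m+[n∸m]≡n Δ≤b))) (identity Δ B a)
    where
    identity : ∀ Δ B a → Δ + B + a ≡ Δ + a + B
    identity = solve-∀

  A≤b : A ≤ b
  A≤b = ≤-trans (+-monoʳ-≤ Δ a≤b∸Δ) (≤-reflexive (m+[n∸m]≡n Δ≤b))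

  K≡ : suc K ≡ A + B + 2 * m
  K≡ = trans (m+[n∸m]≡n {1} (≤-trans (≤-trans (<⇒≤ 2≤a) (m≤n+m a b)) (m≤m+n (b + a) (2 * m))))
             (cong (_+ 2 * m) b+a≡A+B)

  A≤f : ∀ x → A ≤ f x
  A≤f x = let _ , g≤ , a≤g = bounds x in
    ≤-trans (+-monoʳ-≤ Δ (≤-trans a≤g g≤)) (≤-reflexive (m+[n∸m]≡n (Δ≤f (≤-trans a≤g g≤))))
    where
    Δ≤f : a ≤ f x ∸ Δ → Δ ≤ f x
    Δ≤f a≤ with Δ ≤? f x
    ... | yes le = le
    ... | no Δ≰f = contradiction
      (≤-trans (≤-trans 2≤a a≤) (≤-reflexive (m≤n⇒m∸n≡0 (<⇒≤ (≰⇒> Δ≰f))))) λ ()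

  g≤B : ∀ x → g x ≤ B
  g≤B x = let f≤ , g≤ , _ = bounds x in ≤-trans g≤ f≤

  -- Vertices of `U` meet no live edge, so their lower bound is set to 0.
  gˡ : Fin n → ℕ
  gˡ x = live x · g x

  gˡ≤f : ∀ x → gˡ x ≤ f x
  gˡ≤f x with live x
  ... | true  = ≤-trans (proj₁ (proj₂ (bounds x))) (m∸n≤m (f x) Δ)
  ... | false = z≤n

  order′ : (A + B) * K < A * N
  order′ = +-cancelʳ-< (A * n') _ _ (begin-strict
    (A + B) * K + A * n'  ≡⟨ cong (_+ A * n') (trans (*-comm (A + B) K) (cong (K *_) (trans (sym b+a≡A+B) (+-comm b a)))) ⟩
    K * (a + b) + A * n'  <⟨ order ⟩
    A * n                 ≡⟨ cong (A *_) (countB-live U) ⟨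
    A * (N + n')          ≡⟨ *-distribˡ-+ A N n' ⟩
    A * N + A * n'        ∎)

  module _ (S : Fin n → Bool) where

    s : ℕ
    s = size-S G U H H-edges S

    dₛ eₛ : Fin n → ℕ
    dₛ = d G U H H-edges S
    eₛ = e G U H H-edges S

    δ′ : ∀ x → A * m + b * B ≤ A * (dₛ x + s)
    δ′ x = +-cancelʳ-≤ (A * n') _ _ (begin
      A * m + b * B + A * n'      ≡⟨ identity₁ A m (b * B) n' ⟩
      A * (m + n') + b * B        ≤⟨ δ x ⟩
      A * deg G x                 ≤⟨ *-monoʳ-≤ A (deg≤ G U H H-edges S x) ⟩
      A * (n' + (dₛ x + s))       ≡⟨ identity₂ A n' (dₛ x + s) ⟩
      A * (dₛ x + s) + A * n'     ∎)
      where
      identity₁ : ∀ A m c n' → A * m + c + A * n' ≡ A * (m + n') + c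
      identity₁ = solve-∀
      identity₂ : ∀ A n' c → A * (n' + c) ≡ A * c + A * n'
      identity₂ = solve-∀

    ore′ : ∀ x y → x ≢ y → adj G x y ≡ false → B * N ≤ (A + B) * ((dₛ x ⊔ dₛ y) + s)
    ore′ x y x≢y nonadj = +-cancelʳ-≤ ((A + B) * n') _ _ (begin
      -- Here B n' completes `N` to `n`, and A n' is the correction term of the degree hypothesis.
      B * N + (A + B) * n'          ≡⟨ identity₁ A B N n' ⟩
      B * (N + n') + A * n'         ≡⟨ cong (λ k → B * k + A * n') (countB-live U) ⟩
      B * n + A * n'                ≤⟨ ore x y x≢y nonadj ⟩
      (b + a) * (deg G x ⊔ deg G y) ≡⟨ cong (_* (deg G x ⊔ deg G y)) b+a≡A+B ⟩
      (A + B) * (deg G x ⊔ deg G y) ≤⟨ *-monoʳ-≤ (A + B) (⊔-lub (bound x (m≤m⊔n _ _)) (bound y (m≤n⊔m _ _))) ⟩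
      (A + B) * (n' + ((dₛ x ⊔ dₛ y) + s)) ≡⟨ identity₂ (A + B) n' ((dₛ x ⊔ dₛ y) + s) ⟩
      (A + B) * ((dₛ x ⊔ dₛ y) + s) + (A + B) * n' ∎)
      where
      bound : ∀ z {k} → dₛ z ≤ k → deg G z ≤ n' + (k + s)
      bound z le = ≤-trans (deg≤ G U H H-edges S z) (+-monoʳ-≤ n' (+-monoˡ-≤ s le))
      identity₁ : ∀ A B N n' → B * N + (A + B) * n' ≡ B * (N + n') + A * n'
      identity₁ = solve-∀
      identity₂ : ∀ C n' c → C * (n' + c) ≡ C * c + C * n'
      identity₂ = solve-∀

  disjoint : DisjointCutCondition (liveEdges live E) gˡ f
  disjoint T₀ S T₀∩S = ≮⇒≥ λ lt →
    no-violation G U H H-edges S T (λ x Tx → proj₁ (proj₂ (T-elim x Tx)))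
      (λ x Tx → T₀∩S x (proj₁ (T-elim x Tx)))
      A B b K (≤-trans 2≤a (m≤n+m a Δ)) A≤b (m∸n≤m b Δ) K≡ order′ (δ′ S) (ore′ S)
      (λ x Tx → proj₂ (proj₂ (T-elim x Tx))) (violated lt)
    where
    T : Fin n → Bool
    -- Dead vertices have `gˡ` zero, and where `e` is at least `B` it already covers `g`; dropping
    -- both kinds keeps the cut violated.
    T x = T₀ x ∧ live x ∧ ⌊ eₛ S x <? B ⌋

    T-elim : ∀ x → T x ≡ true → T₀ x ≡ true × live x ≡ true × eₛ S x < B
    T-elim x Tx with T₀ x | live x | eₛ S x <? B
    ... | true | true | yes lt = refl , refl , lt

    ∑f : A * s S ≤ sumℕ n (λ y → S y · f y)
    ∑f = ≤-trans (≤-reflexive (sym (∑-distribˡ-* A (λ x → (S x ∧ live x) · 1)))) (∑-mono-≤ pointwise)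
      where
      pointwise : ∀ x → A * (S x ∧ live x) · 1 ≤ S x · f x
      pointwise x with S x | live x
      ... | true  | true  = ≤-trans (≤-reflexive (*-identityʳ A)) (A≤f x)
      ... | true  | false = ≤-trans (≤-reflexive (*-zeroʳ A)) z≤n
      ... | false | _     = ≤-reflexive (*-zeroʳ A)

    ∑g : sumℕ n (λ x → T₀ x · gˡ x) ≤
         sumℕ n (λ x → T₀ x · eₛ S x) + sumℕ n (λ x → T x · (B ∸ eₛ S x))
    ∑g = ≤-trans (∑-mono-≤ pointwise) (≤-reflexive (∑-distrib-+ {n} _ _))
      where
      pointwise : ∀ x → T₀ x · gˡ x ≤ T₀ x · eₛ S x + T x · (B ∸ eₛ S x)
      pointwise x with T₀ x | live x | eₛ S x <? B
      ... | false | _     | _      = z≤n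
      ... | true  | false | _      = z≤n
      ... | true  | true  | yes lt = ≤-trans (g≤B x) (≤-reflexive (sym (m+[n∸m]≡n (<⇒≤ lt))))
      ... | true  | true  | no ≮B  = ≤-trans (g≤B x) (≤-trans (≮⇒≥ ≮B) (m≤m+n _ 0))

    violated : sumℕ n (λ y → S y · f y) + sumℕ n (λ x → T₀ x · eₛ S x) < sumℕ n (λ x → T₀ x · gˡ x) →
               A * s S + 1 ≤ sumℕ n (λ x → T x · (B ∸ eₛ S x))
    violated lt = subst (_≤ sumℕ n (λ x → T x · (B ∸ eₛ S x))) (+-comm 1 (A * s S))
      (+-cancelˡ-< (sumℕ n (λ x → T₀ x · eₛ S x)) _ _ (begin-strict
        sumℕ n (λ x → T₀ x · eₛ S x) + A * s S
          ≡⟨ +-comm (sumℕ n (λ x → T₀ x · eₛ S x)) (A * s S) ⟩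
        A * s S + sumℕ n (λ x → T₀ x · eₛ S x)
          ≤⟨ +-monoˡ-≤ _ ∑f ⟩
        sumℕ n (λ y → S y · f y) + sumℕ n (λ x → T₀ x · eₛ S x)
          <⟨ lt ⟩
        sumℕ n (λ x → T₀ x · gˡ x)
          ≤⟨ ∑g ⟩
        sumℕ n (λ x → T₀ x · eₛ S x) + sumℕ n (λ x → T x · (B ∸ eₛ S x)) ∎))
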